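{- Let $(W,S)$ be a Coxeter system and let $I,J,K,L\subset S$ be finitary. Suppose that $q$ and $q'$ are $(I,J)$-cosets with $q'<q$, and let $p$ be a $(K,I)$-coset and $r$ a $(J,L)$-coset. If $p.q.r$ is a reduced composition, then $$p*q'*r<p.q.r .$$
   Context: $(W,S)$ is a Coxeter system with length function $\ell$. For $I\subset S$, $W_I$ is the subgroup generated by $I$; $I$ is finitary if $W_I$ is finite, and then $w_I$ is its longest element. The $*$-product on $W$ is the associative monoid product determined by $s*w=sw$ if $sw>w$ and $s*w=w$ if $sw<w$ ($s\in S$, $w\in W$), with unit the identity. An $(I,J)$-coset is an element $p\in W_I\backslash W/W_J$ (regarded as a triple $(p,I,J)$). $\overline{p}$ and $\underline{p}$ denote the maximal and minimal elements of the set $p$ in the Bruhat order. For $(I,J)$-cosets, $p\le q$ means $\underline p\le\underline q$, and $p<q$ means $p\le q$ and $p\ne q$. If $p$ is an $(I,J)$-coset and $q$ is a $(J,K)$-coset, $p*q$ is the unique $(I,K)$-coset with $\overline{p*q}=\overline p*\overline q$. A (singlestep) expression is a sequence $I_\bullet=[I_0,I_1,\dots,I_d]$ of finitary subsets of $S$ such that each $I_k$ is obtained from $I_{k-1}$ by adding or removing one element of $S$. It expresses the unique $(I_0,I_d)$-coset $q$ with $\overline{q}=w_{I_0}*w_{I_1}*\cdots*w_{I_d}$. Expressions $[P_0,\dots,P_c]$ and $[Q_0,\dots,Q_d]$ with $P_c=Q_0$ are concatenated to $P_\bullet\circ Q_\bullet=[P_0,\dots,P_c=Q_0,\dots,Q_d]$.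 Reduced expressions: recording the local maxima and minima of $I_\bullet$ gives a multistep expression $I_0=L_0\subset K_1\supset L_1\subset K_2\supset\cdots\subset K_m\supset L_m=I_d$ (with $L_0=K_1$ if $I_\bullet$ starts by decreasing and $K_m=L_m$ if it ends by increasing). $I_\bullet$, expressing $q$, is reduced if $\overline{q}=(w_{K_1}w_{L_1}^{ -1})(w_{K_2}w_{L_2}^{ -1})\cdots(w_{K_{m-1}}w_{L_{m-1}}^{ -1})\,w_{K_m}$ and the length of $\overline q$ is the sum of the lengths of these factors. Reduced composition: for an $(I,J)$-coset $p$, a $(J,K)$-coset $q$ and an $(I,K)$-coset $r$ one writes $p.q=r$, and calls $r$ a reduced composition of $p$ and $q$, if there are reduced expressions $P_\bullet$ of $p$ and $Q_\bullet$ of $q$ such that $P_\bullet\circ Q_\bullet$ is a reduced expression of $r$ (then $r=p*q$). Likewise, $p.q.r$ is a reduced composition if there are reduced expressions $P_\bullet,Q_\bullet,R_\bullet$ of $p,q,r$ such that $P_\bullet\circ Q_\bullet\circ R_\bullet$ is reduced; then $p.q.r$ denotes the coset $p*q*r$ it expresses. -}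

module Defs where

open import Algebra.Bundles using (Group)
open import Data.List.Base using (List; []; _∷_; _++_; concat; foldr; length; map; replicate; sum)
import Data.List.Membership.Setoid as SetoidMembership
open import Data.List.Extrema using (argmax)
open import Data.List.Relation.Unary.All using (All)
open import Data.Nat.Base using (ℕ; _≤_; _<_)
open import Data.Nat.Properties using (_<?_; ≤-totalOrder)
open import Data.Product.Base using (Σ-syntax; ∃-syntax; _×_; _,_)
open import Data.Sum.Base using (_⊎_; inj₁; inj₂)
open import Function.Bundles using (_⇔_)
open import Function.Definitions using (Injective)
open import Level using (Level; _⊔_; suc)
open import Relation.Binary.Construct.Closure.Equivalence using (EqClosure)
open import Relation.Binary.Construct.Closure.ReflexiveTransitive using (Star)
open import Relation.Binary.Core using (Rel)
open import Relation.Binary.PropositionalEquality.Core using (_≡_; _≢_)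
open import Relation.Nullary.Decidable.Core using (yes; no)
open import Relation.Nullary.Negation.Core using (¬_)
open import Relation.Unary using (Pred; _∈_; _∉_; _∪_; ｛_｝; _≐_)

------------------------------------------------------------------------
-- Coxeter systems

-- The group ⟨ S ∣ (st)^m(s,t) ⟩ as words in S modulo EqClosure of Deletion.
-- No inverse letters are needed: m s s ≡ 1 makes every generator an
-- involution.  m s t ≡ 0 encodes m(s,t) = ∞ (the relator is then empty).
module Presentation {a} {S : Set a} (m : S → S → ℕ) where

  relator : S → S → List S
  relator s t = concat (replicate (m s t) (s ∷ t ∷ []))

  data Deletion : Rel (List S) a where
    delete : ∀ u s t v → Deletion (u ++ relator s t ++ v) (u ++ v)

  _~_ : Rel (List S) a
  _~_ = EqClosure Deletion

record CoxeterSystem (c e a : Level) : Set (suc (c ⊔ e ⊔ a)) where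
  field
    group : Group c e
  open Group group public
  field
    -- S is a subset of W, given as an index type with an injection.
    S   : Set a
    ι   : S → Carrier
    ι-injective : Injective _≡_ _≈_ ι

    m         : S → S → ℕ
    m-refl    : ∀ s → m s s ≡ 1
    m-sym     : ∀ s t → m s t ≡ m t s
    m-offdiag : ∀ {s t} → s ≢ t → m s t ≢ 1

  open Presentation m public

  ⟦_⟧ : List S → Carrier
  ⟦_⟧ = foldr (λ s w → ι s ∙ w) ε

  field
    presentation : ∀ u v → ⟦ u ⟧ ≈ ⟦ v ⟧ ⇔ u ~ v

    -- The two properties below determine ℓ (up to pointwise equality) and say
    -- in particular that S generates W.  ℓ is carried as data because it cannot
    -- be defined constructively without deciding equality in W.
    ℓ          : Carrier → ℕ
    ℓ-attained : ∀ w → Σ[ u ∈ List S ] (⟦ u ⟧ ≈ w × length u ≡ ℓ w)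
    ℓ-minimal  : ∀ w u → ⟦ u ⟧ ≈ w → ℓ w ≤ length u

module Coxeter {c e a} (C : CoxeterSystem c e a) where
  open CoxeterSystem C
  open SetoidMembership setoid using () renaming (_∈_ to _∈ₗ_)

  ----------------------------------------------------------------------
  -- Bruhat order

  IsReflection : Pred Carrier (c ⊔ e ⊔ a)
  IsReflection t = ∃[ w ] ∃[ s ] t ≈ w ∙ ι s ∙ w ⁻¹

  _⟶_ : Rel Carrier (c ⊔ e ⊔ a)
  x ⟶ y = ∃[ t ] (IsReflection t × y ≈ x ∙ t × ℓ x < ℓ y)

  _≤ᴮ_ : Rel Carrier (c ⊔ e ⊔ a)
  _≤ᴮ_ = Star (λ x y → x ≈ y ⊎ x ⟶ y)

  ----------------------------------------------------------------------
  -- The *-product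

  -- sw > w in the Bruhat order iff ℓ(w) < ℓ(sw), as sw = w(w⁻¹sw).
  _*ˢ_ : S → Carrier → Carrier
  s *ˢ w with ℓ w <? ℓ (ι s ∙ w)
  ... | yes _ = ι s ∙ w
  ... | no  _ = w

  -- A reduced word s₁⋯sₖ of v satisfies v = s₁ * ⋯ * sₖ, so associativity
  -- forces v * w = s₁ * (⋯ * (sₖ * w)).
  _*_ : Carrier → Carrier → Carrier
  v * w = let (u , _) = ℓ-attained v in foldr _*ˢ_ w u

  ----------------------------------------------------------------------
  -- Parabolic subgroups

  -- Words in I suffice, the generators being involutions.
  Parabolic : Pred S a → Pred Carrier (e ⊔ a)
  Parabolic I w = Σ[ u ∈ List S ] (All I u × ⟦ u ⟧ ≈ w)

  record FinitarySubset : Set (c ⊔ e ⊔ suc a) where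
    field
      subset   : Pred S a
      elements : List Carrier
      complete : ∀ w → w ∈ Parabolic subset ⇔ w ∈ₗ elements

    longest : Carrier
    longest = argmax ≤-totalOrder ℓ ε elements

  open FinitarySubset public

  W[_] : FinitarySubset → Pred Carrier (e ⊔ a)
  W[ I ] = Parabolic (subset I)

  ----------------------------------------------------------------------
  -- Double cosets

  -- The coset W_I rep W_J; different representatives may give the same coset,
  -- and equality of cosets is _≈ᶜ_.
  record Coset (I J : FinitarySubset) : Set c where
    constructor coset
    field
      rep : Carrier

  private
    variable
      I J K L : FinitarySubset

  elems : Coset I J → Pred Carrier (c ⊔ e ⊔ a)
  elems {I} {J} (coset w) x = ∃[ y ] ∃[ z ] (y ∈ W[ I ] × z ∈ W[ J ] × x ≈ y ∙ w ∙ z)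

  _≈ᶜ_ : Rel (Coset I J) (c ⊔ e ⊔ a)
  p ≈ᶜ q = elems p ≐ elems q

  IsMax IsMin : Coset I J → Pred Carrier (c ⊔ e ⊔ a)
  IsMax p x = x ∈ elems p × (∀ y → y ∈ elems p → y ≤ᴮ x)
  IsMin p x = x ∈ elems p × (∀ y → y ∈ elems p → x ≤ᴮ y)

  _≤ᶜ_ _<ᶜ_ : Rel (Coset I J) (c ⊔ e ⊔ a)
  p ≤ᶜ q = ∃[ x ] ∃[ y ] (IsMin p x × IsMin q y × x ≤ᴮ y)
  p <ᶜ q = p ≤ᶜ q × ¬ (p ≈ᶜ q)

  -- r = p * q
  IsProduct : Coset I J → Coset J K → Coset I K → Set (c ⊔ e ⊔ a)
  IsProduct p q r = ∃[ x ] ∃[ y ] (IsMax p x × IsMax q y × IsMax r (x * y))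

  ----------------------------------------------------------------------
  -- Singlestep expressions

  _≐ᶠ_ : Rel FinitarySubset a
  I ≐ᶠ J = subset I ≐ subset J

  _⋖_ : Rel FinitarySubset a
  I ⋖ J = ∃[ s ] (s ∉ subset I × subset J ≐ subset I ∪ ｛ s ｝)

  -- Expression I J consists of the sequences [I₀,…,I_d] with I₀ = I and I_d = J.
  -- Subsets are compared extensionally, so stop, the sequence [I], has both
  -- I and J as (equal) endpoints.
  data Expression : FinitarySubset → FinitarySubset → Set (c ⊔ e ⊔ suc a) where
    stop   : I ≐ᶠ J → Expression I J
    add    : I ⋖ J → Expression J K → Expression I K
    remove : J ⋖ I → Expression J K → Expression I K

  private
    ≐-trans : ∀ {P Q R : Pred S a} → P ≐ Q → Q ≐ R → P ≐ R
    ≐-trans (f , g) (h , k) = (λ x → h (f x)) , (λ x → g (k x))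

    ∪-congˡ : ∀ {P Q R : Pred S a} → P ≐ Q → Q ∪ R ≐ P ∪ R
    ∪-congˡ (f , g) = (λ { (inj₁ x) → inj₁ (g x) ; (inj₂ y) → inj₂ y })
                    , (λ { (inj₁ x) → inj₁ (f x) ; (inj₂ y) → inj₂ y })

  replaceStart : I ≐ᶠ J → Expression J K → Expression I K
  replaceStart eq       (stop eq′)               = stop (≐-trans eq eq′)
  replaceStart (f , g)  (add (s , s∉J , J′≐) E)  =
    add (s , (λ s∈I → s∉J (f s∈I)) , ≐-trans J′≐ (∪-congˡ (f , g))) E
  replaceStart eq       (remove (s , s∉ , J≐) E) = remove (s , s∉ , ≐-trans eq J≐) E

  _∘ᴱ_ : Expression I J → Expression J K → Expression I K
  stop eq     ∘ᴱ F = replaceStart eq F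
  add st E    ∘ᴱ F = add st (E ∘ᴱ F)
  remove st E ∘ᴱ F = remove st (E ∘ᴱ F)

  -- w_{I₀} * ⋯ * w_{I_d}
  starProduct : Expression I J → Carrier
  starProduct {I} (stop _)     = longest I
  starProduct {I} (add _ E)    = longest I * starProduct E
  starProduct {I} (remove _ E) = longest I * starProduct E

  Expresses : Expression I J → Coset I J → Set (c ⊔ e ⊔ a)
  Expresses E q = IsMax q (starProduct E)

  -- risingFactors is the list w_{K₁}w_{L₁}⁻¹, …, w_{K_{m-1}}w_{L_{m-1}}⁻¹, w_{K_m}
  -- for the local maxima Kᵢ and minima Lᵢ of an expression; fallingFactors K
  -- treats the rest of an expression that is descending from the local maximum K.
  mutual
    risingFactors : Expression I J → List Carrier
    risingFactors {I} (stop _)     = longest I ∷ []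
    risingFactors     (add _ E)    = risingFactors E
    risingFactors {I} (remove _ E) = fallingFactors I E

    fallingFactors : FinitarySubset → Expression I J → List Carrier
    fallingFactors     K (stop _)     = longest K ∷ []
    fallingFactors {I} K (add _ E)    = (longest K ∙ longest I ⁻¹) ∷ risingFactors E
    fallingFactors     K (remove _ E) = fallingFactors K E

  Reduced : Expression I J → Set e
  Reduced E = starProduct E ≈ foldr _∙_ ε fs × ℓ (starProduct E) ≡ sum (map ℓ fs)
    where
    fs : List Carrier
    fs = risingFactors E

  ReducedExpressionOf : Coset I J → Expression I J → Set (c ⊔ e ⊔ a)
  ReducedExpressionOf q E = Expresses E q × Reduced E

  -- p.q.r is a reduced composition, denoting the coset t.
  ReducedComposition : Coset I J → Coset J K → Coset K L → Coset I L → Set (c ⊔ e ⊔ suc a)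
  ReducedComposition p q r t =
    ∃[ P ] ∃[ Q ] ∃[ R ] (ReducedExpressionOf p P × ReducedExpressionOf q Q ×
                          ReducedExpressionOf r R × ReducedExpressionOf t (P ∘ᴱ (Q ∘ᴱ R)))

{-# OPTIONS --safe #-}

-- A reduced composition p.q.r is additive: with x, y, z the maximal elements of
-- p, q, r, the maximal element x * y * z of p.q.r has length
-- ℓ x + ℓ y + ℓ z - ℓ w_I - ℓ w_J.  If y′ is the maximal element of q′ then
-- y′ < y in the Bruhat order, so x * y′ * z ≤ x * y * z since * is monotone.
-- Writing x = x₀ w_I with ℓ x = ℓ x₀ + ℓ w_I gives x * y′ = x₀ * y′, likewise
-- on the other side, whence ℓ (x * y′ * z) ≤ ℓ x + ℓ y′ + ℓ z - ℓ w_I - ℓ w_J,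
-- which is smaller than the length of x * y * z.  The Coxeter theory underneath
-- rests on the strong exchange condition, obtained from the presentation by
-- counting modulo 2 how often a reflection occurs in a word.
module Submission where

open import Defs
import Algebra.Properties.CommutativeSemigroup as CommutativeSemigroupProperties
import Algebra.Properties.Group as GroupProperties
import Algebra.Properties.Monoid as MonoidProperties
open import Data.Bool.Base using (Bool; true; false; _xor_)
open import Data.Bool.Properties using (xor-assoc; xor-same)
open import Data.Empty using (⊥)
open import Data.Fin.Base using (Fin; zero; suc)
open import Data.List.Base using (List; []; _∷_; _++_; concat; foldr; foldl; length; map; replicate; reverse; removeAt; cartesianProductWith)
import Data.List.Extrema as Extrema
import Data.List.Membership.Setoid as SetoidMembership
open import Data.List.Membership.Setoid.Properties using (∈-resp-≈; ∈-cartesianProductWith⁺)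
open import Data.List.Properties using (++-identityʳ; length-removeAt′; length-reverse; length-++; unfold-reverse)
open import Data.List.Relation.Binary.Pointwise using (Pointwise-≡⇒≡)
import Data.List.Relation.Binary.Sublist.Heterogeneous.Properties as Sublist
open import Data.List.Relation.Binary.Sublist.Propositional using (_⊆_; []; _∷_; _∷ʳ_; ⊆-refl; ⊆-trans)
open import Data.List.Relation.Binary.Sublist.Propositional.Properties using (All-resp-⊆)
open import Data.List.Relation.Unary.All as All using (All; []; _∷_)
open import Data.List.Relation.Unary.All.Properties using (++⁺; cartesianProductWith⁺)
open import Data.List.Relation.Unary.Any using (here)
open import Data.Nat.Base as ℕ using (ℕ; zero; suc; _≤_; _<_; s≤s)
open import Data.Nat.ListAction using (sum)
import Data.Nat.Properties as ℕ
open import Data.Product.Base using (Σ-syntax; ∃-syntax; _×_; _,_; proj₁; proj₂)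
open import Data.Sum.Base using (_⊎_; inj₁; inj₂)
open import Function.Bundles using (mk⇔; Equivalence)
open import Level using (Lift; lift)
import Relation.Binary.Construct.Closure.Equivalence as Eq
open import Relation.Binary.Construct.Closure.ReflexiveTransitive using (_◅_; _◅◅_) renaming (ε to []⋆)
open import Relation.Binary.Definitions using (Decidable)
import Relation.Binary.PropositionalEquality as ≡
open ≡ using (_≡_)
open import Relation.Nullary.Decidable using (Dec; does; yes; no; does-⇔; map′; dec-true)
open import Relation.Nullary.Negation using (¬_; contradiction)
open import Relation.Unary using (Pred; _∈_)
open import Tactic.MonoidSolver using (solve)

open CommutativeSemigroupProperties ℕ.+-commutativeSemigroup using (interchange; xy∙z≈xz∙y)
open Extrema ℕ.≤-totalOrder using (argmin; argmax; f[xs]≤f[argmax]; f[argmin]≤f[xs]; argmax-all; argmin-all)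

-- `_*_` is computed from one chosen reduced word, so neither independence of that word nor
-- associativity is given. Braid moves are avoided: the left action `_*ˢ_` commutes with its mirror
-- image `_*ʳ_`. From this follow independence and associativity, and `x * y` becomes an iterated
-- right action on x, which gives monotonicity in x. The order on cosets compares minimal elements,
-- whereas products are governed by maximal ones. The lifting property of the Bruhat order bridges
-- the two: if z has all generators of I as left descents and all of J as right descents, then one
-- element below z brings its whole (I,J)-coset below z, even when z lies in another coset. The
-- terms ℓ w_I and ℓ w_J come from the joints. For L inside K the factor w_K w_L⁻¹ has length ℓ w_K
-- - ℓ w_L, so the factor lengths of an expression add up to an alternating sum over peaks and
-- valleys, and concatenation counts the shared endpoint twice.

+-chain-≤ : ∀ n i j x y z k → n ℕ.+ j ≤ k ℕ.+ z → k ℕ.+ i ≤ x ℕ.+ y → n ℕ.+ j ℕ.+ i ≤ x ℕ.+ y ℕ.+ z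
+-chain-≤ n i j x y z k n+j≤k+z k+i≤x+y = begin
  n ℕ.+ j ℕ.+ i    ≤⟨ ℕ.+-monoˡ-≤ i n+j≤k+z ⟩
  k ℕ.+ z ℕ.+ i    ≡⟨ xy∙z≈xz∙y k z i ⟩
  k ℕ.+ i ℕ.+ z    ≤⟨ ℕ.+-monoˡ-≤ z k+i≤x+y ⟩
  x ℕ.+ y ℕ.+ z    ∎
  where open ℕ.≤-Reasoning

+-chain-≡ : ∀ n i j x y z k → n ℕ.+ i ≡ x ℕ.+ k → k ℕ.+ j ≡ y ℕ.+ z → n ℕ.+ j ℕ.+ i ≡ x ℕ.+ y ℕ.+ z
+-chain-≡ n i j x y z k n+i≡x+k k+j≡y+z = begin
  n ℕ.+ j ℕ.+ i      ≡⟨ xy∙z≈xz∙y n j i ⟩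
  n ℕ.+ i ℕ.+ j      ≡⟨ ≡.cong (ℕ._+ j) n+i≡x+k ⟩
  x ℕ.+ k ℕ.+ j      ≡⟨ ℕ.+-assoc x k j ⟩
  x ℕ.+ (k ℕ.+ j)    ≡⟨ ≡.cong (x ℕ.+_) k+j≡y+z ⟩
  x ℕ.+ (y ℕ.+ z)    ≡⟨ ℕ.+-assoc x y z ⟨
  x ℕ.+ y ℕ.+ z      ∎
  where open ≡.≡-Reasoning

+-eliminate : ∀ f j k r g i → f ℕ.+ j ≡ k ℕ.+ r → g ℕ.+ j ≡ i ℕ.+ r → f ℕ.+ i ≡ k ℕ.+ g
+-eliminate f j k r g i f+j≡k+r g+j≡i+r = ℕ.+-cancelʳ-≡ (j ℕ.+ r) _ _ (begin
  f ℕ.+ i ℕ.+ (j ℕ.+ r)      ≡⟨ interchange f i j r ⟩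
  f ℕ.+ j ℕ.+ (i ℕ.+ r)      ≡⟨ ≡.cong₂ ℕ._+_ f+j≡k+r (≡.sym g+j≡i+r) ⟩
  k ℕ.+ r ℕ.+ (g ℕ.+ j)      ≡⟨ interchange k r g j ⟩
  k ℕ.+ g ℕ.+ (r ℕ.+ j)      ≡⟨ ≡.cong (k ℕ.+ g ℕ.+_) (ℕ.+-comm r j) ⟩
  k ℕ.+ g ℕ.+ (j ℕ.+ r)      ∎)
  where open ≡.≡-Reasoning

module _ {c e a} (C : CoxeterSystem c e a) where

  open CoxeterSystem C
  open Coxeter C renaming
    ( _≤ᴮ_ to infix 4 _≤ᴮ_; _⟶_ to infix 4 _⟶_
    ; _*_ to infixl 7 _*_; _*ˢ_ to infixr 7 _*ˢ_; _∘ᴱ_ to infixr 5 _∘ᴱ_ )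
  open GroupProperties group
  open MonoidProperties monoid using (cancelˡ; cancelʳ; cancelᶜ; elimˡ)
  open SetoidMembership setoid using () renaming (_∈_ to _∈ₗ_)
  open import Relation.Binary.Reasoning.Setoid setoid

  -- Words and length

  ⟦⟧-++ : ∀ u v → ⟦ u ++ v ⟧ ≈ ⟦ u ⟧ ∙ ⟦ v ⟧
  ⟦⟧-++ []      v = sym (identityˡ _)
  ⟦⟧-++ (s ∷ u) v = trans (∙-congˡ (⟦⟧-++ u v)) (sym (assoc _ _ _))

  word : Carrier → List S
  word w = proj₁ (ℓ-attained w)

  ⟦word⟧ : ∀ w → ⟦ word w ⟧ ≈ w
  ⟦word⟧ w = proj₁ (proj₂ (ℓ-attained w))

  length-word : ∀ w → length (word w) ≡ ℓ w
  length-word w = proj₂ (proj₂ (ℓ-attained w))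

  ℓ-mono-≈ : ∀ {x y} → x ≈ y → ℓ y ≤ ℓ x
  ℓ-mono-≈ {x} {y} x≈y =
    ≡.subst (ℓ y ≤_) (length-word x) (ℓ-minimal y (word x) (trans (⟦word⟧ x) x≈y))

  ℓ-cong : ∀ {x y} → x ≈ y → ℓ x ≡ ℓ y
  ℓ-cong x≈y = ℕ.≤-antisym (ℓ-mono-≈ (sym x≈y)) (ℓ-mono-≈ x≈y)

  ℓ-⟦⟧ : ∀ u → ℓ ⟦ u ⟧ ≤ length u
  ℓ-⟦⟧ u = ℓ-minimal ⟦ u ⟧ u refl

  ℓ-ε : ℓ ε ≡ 0
  ℓ-ε = ℕ.n≤0⇒n≡0 (ℓ-⟦⟧ [])

  ℓ≡0⇒≈ε : ∀ {x} → ℓ x ≡ 0 → x ≈ ε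
  ℓ≡0⇒≈ε {x} ℓx≡0 with word x | ⟦word⟧ x | length-word x
  ... | []    | eq | _   = sym eq
  ... | _ ∷ _ | _  | len with () ← ≡.trans len ℓx≡0

  ℓ-∙ : ∀ x y → ℓ (x ∙ y) ≤ ℓ x ℕ.+ ℓ y
  ℓ-∙ x y = ≡.subst (ℓ (x ∙ y) ≤_)
    (≡.trans (length-++ (word x)) (≡.cong₂ ℕ._+_ (length-word x) (length-word y)))
    (ℓ-minimal _ (word x ++ word y) (trans (⟦⟧-++ (word x) (word y)) (∙-cong (⟦word⟧ x) (⟦word⟧ y))))

  ℓ-ι∙ : ∀ s x → ℓ (ι s ∙ x) ≤ suc (ℓ x)
  ℓ-ι∙ s x = ≡.subst (λ n → ℓ (ι s ∙ x) ≤ suc n) (length-word x)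
    (ℓ-minimal _ (s ∷ word x) (∙-congˡ (⟦word⟧ x)))

  -- The given ℓ takes values in ℕ and vanishes only at the identity, which makes equality in W
  -- decidable. Counting occurrences of a reflection depends on this.
  _≟_ : Decidable _≈_
  x ≟ y = map′ (λ eq → x∙y⁻¹≈ε⇒x≈y x y (ℓ≡0⇒≈ε eq))
               (λ x≈y → ≡.trans (ℓ-cong (x≈y⇒x∙y⁻¹≈ε x≈y)) ℓ-ε)
               (ℓ (x ∙ y ⁻¹) ℕ.≟ 0)

  -- Involutions

  ⟦relator⟧ : ∀ s t → ⟦ relator s t ⟧ ≈ ε
  ⟦relator⟧ s t = ≡.subst (λ u → ⟦ u ⟧ ≈ ε) (++-identityʳ (relator s t))
    (Equivalence.from (presentation _ _) (Eq.return (delete [] s t [])))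

  ι² : ∀ s → ι s ∙ ι s ≈ ε
  ι² s with ⟦relator⟧ s s
  ... | eq rewrite m-refl s = trans (∙-congˡ (sym (identityʳ _))) eq

  ι⁻¹ : ∀ s → ι s ⁻¹ ≈ ι s
  ι⁻¹ s = sym (inverseˡ-unique _ _ (ι² s))

  ι-cancelˡ : ∀ s x → ι s ∙ (ι s ∙ x) ≈ x
  ι-cancelˡ s = cancelˡ (ι² s)

  ι-cancelʳ : ∀ s x → (x ∙ ι s) ∙ ι s ≈ x
  ι-cancelʳ s = cancelʳ (ι² s)

  ⟦reverse⟧ : ∀ u → ⟦ reverse u ⟧ ≈ ⟦ u ⟧ ⁻¹
  ⟦reverse⟧ []      = sym ε⁻¹≈ε
  ⟦reverse⟧ (s ∷ u) = begin
    ⟦ reverse (s ∷ u) ⟧            ≡⟨ ≡.cong ⟦_⟧ (unfold-reverse s u) ⟩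
    ⟦ reverse u ++ s ∷ [] ⟧        ≈⟨ ⟦⟧-++ (reverse u) _ ⟩
    ⟦ reverse u ⟧ ∙ (ι s ∙ ε)      ≈⟨ ∙-cong (⟦reverse⟧ u) (trans (identityʳ _) (sym (ι⁻¹ s))) ⟩
    ⟦ u ⟧ ⁻¹ ∙ ι s ⁻¹              ≈⟨ ⁻¹-anti-homo-∙ _ _ ⟨
    ⟦ s ∷ u ⟧ ⁻¹                   ∎

  ℓ-⁻¹≤ : ∀ x → ℓ (x ⁻¹) ≤ ℓ x
  ℓ-⁻¹≤ x = ≡.subst (ℓ (x ⁻¹) ≤_) (≡.trans (length-reverse (word x)) (length-word x))
    (ℓ-minimal _ (reverse (word x)) (trans (⟦reverse⟧ (word x)) (⁻¹-cong (⟦word⟧ x))))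

  ℓ-⁻¹ : ∀ x → ℓ (x ⁻¹) ≡ ℓ x
  ℓ-⁻¹ x = ℕ.≤-antisym (ℓ-⁻¹≤ x) (≡.subst (_≤ ℓ (x ⁻¹)) (ℓ-cong (⁻¹-involutive x)) (ℓ-⁻¹≤ (x ⁻¹)))

  ι∙-⁻¹ : ∀ s x → (x ∙ ι s) ⁻¹ ≈ ι s ∙ x ⁻¹
  ι∙-⁻¹ s x = trans (⁻¹-anti-homo-∙ x (ι s)) (∙-congʳ (ι⁻¹ s))

  ℓ-∙ι : ∀ s x → ℓ (x ∙ ι s) ≡ ℓ (ι s ∙ x ⁻¹)
  ℓ-∙ι s x = ≡.trans (≡.sym (ℓ-⁻¹ _)) (ℓ-cong (ι∙-⁻¹ s x))

  -- The strong exchange condition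

  -- Oriented as a right action: passing to the tail of a word conjugates by its first letter, so
  -- prefixes compose in reading order.
  conj : Carrier → Carrier → Carrier
  conj g x = g ⁻¹ ∙ x ∙ g

  conj-cong : ∀ {g h x y} → g ≈ h → x ≈ y → conj g x ≈ conj h y
  conj-cong g≈h x≈y = ∙-cong (∙-cong (⁻¹-cong g≈h) x≈y) g≈h

  conj-∙ : ∀ g h x → conj (g ∙ h) x ≈ conj h (conj g x)
  conj-∙ g h x = begin
    (g ∙ h) ⁻¹ ∙ x ∙ (g ∙ h)       ≈⟨ ∙-congʳ (∙-congʳ (⁻¹-anti-homo-∙ g h)) ⟩
    (h ⁻¹ ∙ g ⁻¹) ∙ x ∙ (g ∙ h)    ≈⟨ solve monoid ⟩
    h ⁻¹ ∙ (g ⁻¹ ∙ x ∙ g) ∙ h      ∎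

  conj-ε : ∀ x → conj ε x ≈ x
  conj-ε x = trans (identityʳ _) (trans (∙-congʳ ε⁻¹≈ε) (identityˡ x))

  conj-self : ∀ x → conj x x ≈ x
  conj-self x = elimˡ (inverseˡ x) x

  conj⁻¹ : ∀ g x → conj g (g ∙ x ∙ g ⁻¹) ≈ x
  conj⁻¹ g x = begin
    g ⁻¹ ∙ (g ∙ x ∙ g ⁻¹) ∙ g      ≈⟨ ∙-congʳ (∙-congˡ (assoc _ _ _)) ⟩
    g ⁻¹ ∙ (g ∙ (x ∙ g ⁻¹)) ∙ g    ≈⟨ ∙-congʳ (cancelˡ (inverseˡ g) _) ⟩
    x ∙ g ⁻¹ ∙ g                   ≈⟨ cancelʳ (inverseˡ g) x ⟩
    x                              ∎

  ∙-conj : ∀ g x → g ∙ conj g x ≈ x ∙ g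
  ∙-conj g x = trans (∙-congˡ (assoc _ _ _)) (cancelˡ (inverseʳ g) _)

  δ : Carrier → Carrier → Bool
  δ x y = does (x ≟ y)

  δ-⇔ : ∀ {x y z w} → (x ≈ y → z ≈ w) → (z ≈ w → x ≈ y) → δ x y ≡ δ z w
  δ-⇔ {x} {y} {z} {w} f g = does-⇔ (mk⇔ f g) (x ≟ y) (z ≟ w)

  δ-cong : ∀ {x y z w} → x ≈ z → y ≈ w → δ x y ≡ δ z w
  δ-cong x≈z y≈w = δ-⇔ (λ eq → trans (sym x≈z) (trans eq y≈w)) (λ eq → trans x≈z (trans eq (sym y≈w)))

  δ-conj : ∀ g x y → δ (conj g x) y ≡ δ x (g ∙ y ∙ g ⁻¹)
  δ-conj g x y = δ-⇔
    (λ eq → begin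
      x                       ≈⟨ cancelʳ (inverseʳ g) x ⟨
      x ∙ g ∙ g ⁻¹            ≈⟨ ∙-congʳ (∙-conj g x) ⟨
      g ∙ conj g x ∙ g ⁻¹     ≈⟨ ∙-congʳ (∙-congˡ eq) ⟩
      g ∙ y ∙ g ⁻¹            ∎)
    (λ eq → trans (conj-cong refl eq) (conj⁻¹ g y))

  -- The parity of the number of times x occurs among the reflections
  -- s₁⋯sₖ₋₁ sₖ sₖ₋₁⋯s₁ of the word s₁⋯sₙ.
  parity : List S → Carrier → Bool
  parity []      x = false
  parity (s ∷ u) x = δ x (ι s) xor parity u (conj (ι s) x)

  parity-cong : ∀ u {x y} → x ≈ y → parity u x ≡ parity u y
  parity-cong []      x≈y = ≡.refl
  parity-cong (s ∷ u) x≈y = ≡.cong₂ _xor_ (δ-cong x≈y refl) (parity-cong u (conj-cong refl x≈y))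

  -- The cocycle identity: in `u ++ v` the reflections of v appear conjugated by the prefix u, which
  -- `conj ⟦ u ⟧` undoes.
  parity-++ : ∀ u v x → parity (u ++ v) x ≡ parity u x xor parity v (conj ⟦ u ⟧ x)
  parity-++ []      v x = parity-cong v (sym (conj-ε x))
  parity-++ (s ∷ u) v x = ≡.trans
    (≡.cong (δ x (ι s) xor_) (≡.trans (parity-++ u v _)
      (≡.cong (parity u (conj (ι s) x) xor_) (parity-cong v (sym (conj-∙ (ι s) ⟦ u ⟧ x))))))
    (≡.sym (xor-assoc (δ x (ι s)) _ _))

  -- The parity of the number of j < k with x = gʲy.
  orbit : ℕ → Carrier → Carrier → Carrier → Bool
  orbit zero    g y x = false
  orbit (suc k) g y x = δ x y xor orbit k g (g ∙ y) x

  orbit-cong : ∀ k g {y z} x → y ≈ z → orbit k g y x ≡ orbit k g z x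
  orbit-cong zero    g x y≈z = ≡.refl
  orbit-cong (suc k) g x y≈z = ≡.cong₂ _xor_ (δ-cong refl y≈z) (orbit-cong k g x (∙-congˡ y≈z))

  orbit-conj : ∀ k g y x → orbit k g y (conj g x) ≡ orbit k g (g ∙ y ∙ g ⁻¹) x
  orbit-conj zero    g y x = ≡.refl
  orbit-conj (suc k) g y x = ≡.cong₂ _xor_ (δ-conj g x y)
    (≡.trans (orbit-conj k g (g ∙ y) x) (orbit-cong k g x (assoc g (g ∙ y) (g ⁻¹))))

  power : ℕ → S → S → List S
  power k s t = concat (replicate k (s ∷ t ∷ []))

  ⟦power⟧-comm : ∀ k s t → ⟦ power k s t ⟧ ∙ (ι s ∙ ι t) ≈ (ι s ∙ ι t) ∙ ⟦ power k s t ⟧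
  ⟦power⟧-comm zero    s t = trans (identityˡ _) (sym (identityʳ _))
  ⟦power⟧-comm (suc k) s t = begin
    (ι s ∙ (ι t ∙ ⟦ power k s t ⟧)) ∙ (ι s ∙ ι t)   ≈⟨ solve monoid ⟩
    (ι s ∙ ι t) ∙ (⟦ power k s t ⟧ ∙ (ι s ∙ ι t))   ≈⟨ ∙-congˡ (⟦power⟧-comm k s t) ⟩
    (ι s ∙ ι t) ∙ ((ι s ∙ ι t) ∙ ⟦ power k s t ⟧)   ≈⟨ ∙-congˡ (assoc _ _ _) ⟩
    (ι s ∙ ι t) ∙ (ι s ∙ (ι t ∙ ⟦ power k s t ⟧))   ∎

  orbit-+ : ∀ k n s t y x → orbit (k ℕ.+ n) (ι s ∙ ι t) y x ≡
            orbit k (ι s ∙ ι t) y x xor orbit n (ι s ∙ ι t) (⟦ power k s t ⟧ ∙ y) x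
  orbit-+ zero    n s t y x = orbit-cong n _ x (sym (identityˡ y))
  orbit-+ (suc k) n s t y x = ≡.trans
    (≡.cong (δ x y xor_) (≡.trans (orbit-+ k n s t _ x) (≡.cong (orbit k _ _ x xor_) (orbit-cong n _ x eq))))
    (≡.sym (xor-assoc (δ x y) _ _))
    where
    eq : ⟦ power k s t ⟧ ∙ ((ι s ∙ ι t) ∙ y) ≈ ⟦ power (suc k) s t ⟧ ∙ y
    eq = trans (sym (assoc _ _ _)) (∙-congʳ (trans (⟦power⟧-comm k s t) (assoc _ _ _)))

  parity-power : ∀ k s t x → parity (power k s t) x ≡ orbit (k ℕ.+ k) (ι s ∙ ι t) (ι s) x
  parity-power zero    s t x = ≡.refl
  parity-power (suc k) s t x rewrite ℕ.+-suc k k = ≡.cong (δ x (ι s) xor_) (≡.cong₂ _xor_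
    (≡.trans (δ-conj (ι s) x (ι t)) (δ-cong refl (∙-congˡ (ι⁻¹ s))))
    (≡.trans (parity-power k s t _)
    (≡.trans (orbit-cong-x (sym (conj-∙ (ι s) (ι t) x)))
    -- The first two letters account for s and (st)s. Conjugating by st moves the start of the
    -- remaining orbit from s to (st)s(st)⁻¹ = (st)²s, exactly the next term.
    (≡.trans (orbit-conj (k ℕ.+ k) (ι s ∙ ι t) (ι s) x)
      (orbit-cong (k ℕ.+ k) _ x eq)))))
    where
    orbit-cong-x : ∀ {x y} → x ≈ y → orbit (k ℕ.+ k) (ι s ∙ ι t) (ι s) x ≡ orbit (k ℕ.+ k) (ι s ∙ ι t) (ι s) y
    orbit-cong-x x≈y = ≡.trans (≡.sym (parity-power k s t _))
      (≡.trans (parity-cong (power k s t) x≈y) (parity-power k s t _))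

    eq : (ι s ∙ ι t) ∙ ι s ∙ (ι s ∙ ι t) ⁻¹ ≈ (ι s ∙ ι t) ∙ (ι s ∙ ι t ∙ ι s)
    eq = trans (∙-congˡ (trans (⁻¹-anti-homo-∙ _ _) (∙-cong (ι⁻¹ t) (ι⁻¹ s))))
      (trans (assoc _ _ _) (∙-congˡ (sym (assoc _ _ _))))

  -- The reflections of (st)ᵐ are (st)ʲs for j < 2m; as (st)ᵐ = 1, each occurs twice.
  parity-relator : ∀ s t x → parity (relator s t) x ≡ false
  parity-relator s t x = ≡.trans (parity-power (m s t) s t x)
    (≡.trans (orbit-+ (m s t) (m s t) s t (ι s) x)
    (≡.trans (≡.cong (orbit (m s t) _ _ x xor_)
        (orbit-cong (m s t) _ x (elimˡ (⟦relator⟧ s t) (ι s))))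
      (xor-same (orbit (m s t) _ _ x))))

  parity-Deletion : ∀ {u v} x → Deletion u v → parity u x ≡ parity v x
  parity-Deletion x (delete u s t v) = ≡.trans (parity-++ u _ x) (≡.trans
    (≡.cong (parity u x xor_) (≡.trans (parity-++ (relator s t) v _)
      (≡.cong₂ _xor_ (parity-relator s t _)
        (parity-cong v (trans (conj-cong (⟦relator⟧ s t) refl) (conj-ε _))))))
    (≡.sym (parity-++ u v x)))

  -- Here the presentation enters: `parity` is unchanged by each deletion of a relator, hence is a
  -- function on W.
  parity-≈ : ∀ u v x → ⟦ u ⟧ ≈ ⟦ v ⟧ → parity u x ≡ parity v x
  parity-≈ u v x eq = Eq.gfold ≡.isEquivalence (λ w → parity w x) (parity-Deletion x)
    (Equivalence.to (presentation u v) eq)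

  -- The word `u ++ reverse u` represents the identity, so by the cocycle identity its two halves
  -- contribute equal parities.
  parity-⁻¹ : ∀ u x → parity (reverse u) (conj ⟦ u ⟧ x) ≡ parity u x
  parity-⁻¹ u x = xor≡false _ _ (≡.trans (≡.sym (parity-++ u (reverse u) x)) (parity-≈ (u ++ reverse u) [] x
    (trans (⟦⟧-++ u (reverse u)) (trans (∙-congˡ (⟦reverse⟧ u)) (inverseʳ _)))))
    where
    xor≡false : ∀ a b → a xor b ≡ false → b ≡ a
    xor≡false false b eq = eq
    xor≡false true true eq = ≡.refl

  -- The outer halves of the palindrome contribute equally and cancel modulo 2; only the middle
  -- letter remains.
  parity-reflection : ∀ u s x → x ≈ ⟦ u ⟧ ∙ ι s ∙ ⟦ u ⟧ ⁻¹ → parity (u ++ s ∷ reverse u) x ≡ true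
  parity-reflection u s x eq = ≡.trans (parity-++ u (s ∷ reverse u) x) (≡.trans
    (≡.cong (parity u x xor_) (≡.cong₂ _xor_ (dec-true (_ ≟ _) x^u≈s)
      (≡.trans (parity-cong (reverse u) x^us≈x^u) (parity-⁻¹ u x))))
    (xor-not (parity u x)))
    where
    x^u≈s : conj ⟦ u ⟧ x ≈ ι s
    x^u≈s = trans (conj-cong refl eq) (conj⁻¹ ⟦ u ⟧ (ι s))
    x^us≈x^u : conj (ι s) (conj ⟦ u ⟧ x) ≈ conj ⟦ u ⟧ x
    x^us≈x^u = trans (conj-cong refl x^u≈s) (trans (conj-self (ι s)) (sym x^u≈s))
    xor-not : ∀ b → b xor (true xor b) ≡ true
    xor-not false = ≡.refl
    xor-not true  = ≡.refl

  -- Odd parity makes x one of the reflections s₁⋯sᵢ⋯s₁ of the word, and left multiplication by that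
  -- reflection deletes sᵢ.
  parity⇒removal : ∀ u x → parity u x ≡ true → Σ[ i ∈ Fin (length u) ] ⟦ removeAt u i ⟧ ≈ x ∙ ⟦ u ⟧
  parity⇒removal (s ∷ u) x = decided (x ≟ ι s)
    where
    decided : (x≟s : Dec (x ≈ ι s)) → does x≟s xor parity u (conj (ι s) x) ≡ true →
              Σ[ i ∈ Fin (length (s ∷ u)) ] ⟦ removeAt (s ∷ u) i ⟧ ≈ x ∙ ⟦ s ∷ u ⟧
    decided (yes x≈s) _   = zero , sym (trans (∙-congʳ x≈s) (ι-cancelˡ s _))
    decided (no _)    odd with parity⇒removal u (conj (ι s) x) odd
    ... | i , eq = suc i , (begin
      ι s ∙ ⟦ removeAt u i ⟧           ≈⟨ ∙-congˡ eq ⟩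
      ι s ∙ (conj (ι s) x ∙ ⟦ u ⟧)     ≈⟨ assoc _ _ _ ⟨
      ι s ∙ conj (ι s) x ∙ ⟦ u ⟧       ≈⟨ ∙-congʳ (∙-conj (ι s) x) ⟩
      x ∙ ι s ∙ ⟦ u ⟧                  ≈⟨ assoc _ _ _ ⟩
      x ∙ (ι s ∙ ⟦ u ⟧)                ∎)

  reflection² : ∀ {t} → IsReflection t → t ∙ t ≈ ε
  reflection² {t} (w , s , t≈) = begin
    t ∙ t                                    ≈⟨ ∙-cong t≈ t≈ ⟩
    (w ∙ ι s ∙ w ⁻¹) ∙ (w ∙ ι s ∙ w ⁻¹)      ≈⟨ assoc _ _ _ ⟩
    (w ∙ ι s) ∙ (w ⁻¹ ∙ (w ∙ ι s ∙ w ⁻¹))    ≈⟨ ∙-congˡ (∙-congˡ (assoc _ _ _)) ⟩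
    (w ∙ ι s) ∙ (w ⁻¹ ∙ (w ∙ (ι s ∙ w ⁻¹)))  ≈⟨ ∙-congˡ (cancelˡ (inverseˡ w) _) ⟩
    (w ∙ ι s) ∙ (ι s ∙ w ⁻¹)                 ≈⟨ cancelᶜ (ι² s) w (w ⁻¹) ⟩
    w ∙ w ⁻¹                                 ≈⟨ inverseʳ w ⟩
    ε                                        ∎

  ⟦removeAt⟧-ℓ : ∀ u i → ℓ ⟦ removeAt u i ⟧ < length u
  ⟦removeAt⟧-ℓ u i = ≡.subst (suc (ℓ ⟦ removeAt u i ⟧) ≤_) (≡.sym (length-removeAt′ u i)) (s≤s (ℓ-⟦⟧ (removeAt u i)))

  -- If t has odd parity in u, it deletes a letter of u. Otherwise it has odd parity in every word
  -- of tu, since a palindrome for t adds an odd count; deleting a letter from a reduced word of tu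
  -- then gives ℓ u < ℓ (tu), against the hypothesis. The weak inequality lets the lemma also
  -- exclude equal lengths, and u may be a nonreduced word, as the lifting argument requires.
  exchange : ∀ {t} u → IsReflection t → ℓ (t ∙ ⟦ u ⟧) ≤ ℓ ⟦ u ⟧ →
             Σ[ i ∈ Fin (length u) ] ⟦ removeAt u i ⟧ ≈ t ∙ ⟦ u ⟧
  exchange {t} u t-refl@(w , s , t≈) ℓtu≤ℓu with parity u t in eq
  ... | true  = parity⇒removal u t eq
  ... | false with parity⇒removal (word (t ∙ ⟦ u ⟧)) t odd
    where
    r = word w
    t≈′ : t ≈ ⟦ r ⟧ ∙ ι s ∙ ⟦ r ⟧ ⁻¹
    t≈′ = trans t≈ (∙-cong (∙-congʳ (sym (⟦word⟧ w))) (⁻¹-cong (sym (⟦word⟧ w))))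
    palindrome = r ++ s ∷ reverse r
    ⟦palindrome⟧ : ⟦ palindrome ⟧ ≈ t
    ⟦palindrome⟧ = trans (⟦⟧-++ r _) (trans (sym (assoc _ _ _)) (trans (∙-congˡ (⟦reverse⟧ r)) (sym t≈′)))
    odd : parity (word (t ∙ ⟦ u ⟧)) t ≡ true
    odd = ≡.trans (parity-≈ (word (t ∙ ⟦ u ⟧)) (palindrome ++ u) t (trans (⟦word⟧ _)
            (sym (trans (⟦⟧-++ palindrome u) (∙-congʳ ⟦palindrome⟧)))))
          (≡.trans (parity-++ palindrome u t) (≡.cong₂ _xor_ (parity-reflection r s t t≈′)
            (≡.trans (parity-cong u (trans (conj-cong ⟦palindrome⟧ refl) (conj-self t))) eq)))
  ...   | i , removed = contradiction ℓtu≤ℓu (ℕ.<⇒≱ (≡.subst₂ _<_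
    (ℓ-cong (trans removed (trans (∙-congˡ (⟦word⟧ _)) (cancelˡ (reflection² t-refl) _))))
    (length-word _) (⟦removeAt⟧-ℓ (word (t ∙ ⟦ u ⟧)) i)))

  ι-reflection : ∀ s → IsReflection (ι s)
  ι-reflection s = ε , s , sym (trans (∙-cong (identityˡ _) ε⁻¹≈ε) (identityʳ _))

  conj-reflection : ∀ {t} g → IsReflection t → IsReflection (g ∙ t ∙ g ⁻¹)
  conj-reflection {t} g (w , s , t≈) = g ∙ w , s , (begin
    g ∙ t ∙ g ⁻¹                      ≈⟨ ∙-congʳ (∙-congˡ t≈) ⟩
    g ∙ (w ∙ ι s ∙ w ⁻¹) ∙ g ⁻¹       ≈⟨ solve monoid ⟩
    g ∙ w ∙ ι s ∙ (w ⁻¹ ∙ g ⁻¹)       ≈⟨ ∙-congˡ (⁻¹-anti-homo-∙ g w) ⟨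
    g ∙ w ∙ ι s ∙ (g ∙ w) ⁻¹          ∎)

  ℓ≤ℓ-ι∙ : ∀ s x → ℓ x ≤ suc (ℓ (ι s ∙ x))
  ℓ≤ℓ-ι∙ s x = ≡.subst (_≤ suc (ℓ (ι s ∙ x))) (ℓ-cong (ι-cancelˡ s x)) (ℓ-ι∙ s (ι s ∙ x))

  -- Equality cannot occur: exchange writes sx as a reduced word of x with one letter deleted.
  ℓ-ι∙≤⇒< : ∀ s x → ℓ (ι s ∙ x) ≤ ℓ x → ℓ (ι s ∙ x) < ℓ x
  ℓ-ι∙≤⇒< s x le with exchange (word x) (ι-reflection s)
        (≡.subst₂ _≤_ (ℓ-cong (∙-congˡ (sym (⟦word⟧ x)))) (ℓ-cong (sym (⟦word⟧ x))) le)
  ... | i , eq = ≡.subst₂ _<_ (ℓ-cong (trans eq (∙-congˡ (⟦word⟧ x)))) (length-word x) (⟦removeAt⟧-ℓ (word x) i)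

  -- Bruhat order

  ≤ᴮ-reflexive : ∀ {x y} → x ≈ y → x ≤ᴮ y
  ≤ᴮ-reflexive x≈y = inj₁ x≈y ◅ []⋆

  ≤ᴮ-refl : ∀ {x} → x ≤ᴮ x
  ≤ᴮ-refl = []⋆

  ⟶⇒≤ᴮ : ∀ {x y} → x ⟶ y → x ≤ᴮ y
  ⟶⇒≤ᴮ x⟶y = inj₂ x⟶y ◅ []⋆

  ≤ᴮ-trans : ∀ {x y z} → x ≤ᴮ y → y ≤ᴮ z → x ≤ᴮ z
  ≤ᴮ-trans = _◅◅_

  ≤ᴮ-resp : ∀ {x y z w} → x ≈ z → y ≈ w → x ≤ᴮ y → z ≤ᴮ w
  ≤ᴮ-resp x≈z y≈w x≤y = ≤ᴮ-trans (≤ᴮ-reflexive (sym x≈z)) (≤ᴮ-trans x≤y (≤ᴮ-reflexive y≈w))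

  ≤ᴮ⇒ℓ≤ : ∀ {x y} → x ≤ᴮ y → ℓ x ≤ ℓ y
  ≤ᴮ⇒ℓ≤ []⋆                              = ℕ.≤-refl
  ≤ᴮ⇒ℓ≤ (inj₁ x≈z ◅ z≤y)                 = ℕ.≤-trans (ℕ.≤-reflexive (ℓ-cong x≈z)) (≤ᴮ⇒ℓ≤ z≤y)
  ≤ᴮ⇒ℓ≤ (inj₂ (_ , _ , _ , ℓx<ℓz) ◅ z≤y) = ℕ.≤-trans (ℕ.<⇒≤ ℓx<ℓz) (≤ᴮ⇒ℓ≤ z≤y)

  ≤ᴮ∧ℓ≥⇒≈ : ∀ {x y} → x ≤ᴮ y → ℓ y ≤ ℓ x → x ≈ y
  ≤ᴮ∧ℓ≥⇒≈ []⋆                le = refl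
  ≤ᴮ∧ℓ≥⇒≈ (inj₁ x≈z ◅ z≤y)   le = trans x≈z (≤ᴮ∧ℓ≥⇒≈ z≤y (ℕ.≤-trans le (ℕ.≤-reflexive (ℓ-cong x≈z))))
  ≤ᴮ∧ℓ≥⇒≈ (inj₂ (_ , _ , _ , ℓx<ℓz) ◅ z≤y) le =
    contradiction (ℕ.≤-trans ℓx<ℓz (≤ᴮ⇒ℓ≤ z≤y)) (ℕ.≤⇒≯ le)

  ≤ᴮ-antisym : ∀ {x y} → x ≤ᴮ y → y ≤ᴮ x → x ≈ y
  ≤ᴮ-antisym x≤y y≤x = ≤ᴮ∧ℓ≥⇒≈ x≤y (≤ᴮ⇒ℓ≤ y≤x)

  -- `_⟶_` multiplies on the right, so left multiplication by s is rewritten as right multiplication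
  -- by the reflection x⁻¹sx.
  ⟶-ι∙ : ∀ {s x} → ℓ x < ℓ (ι s ∙ x) → x ⟶ ι s ∙ x
  ⟶-ι∙ {s} {x} lt = x ⁻¹ ∙ ι s ∙ x ⁻¹ ⁻¹ , conj-reflection (x ⁻¹) (ι-reflection s) ,
    sym (trans (∙-congˡ (∙-congˡ (⁻¹-involutive x))) (∙-conj x (ι s))) , lt

  ⟶-∙ι : ∀ {s x} → ℓ x < ℓ (x ∙ ι s) → x ⟶ x ∙ ι s
  ⟶-∙ι {s} lt = ι s , ι-reflection s , refl , lt

  ι∙-≤ᴮ : ∀ s x → ℓ (ι s ∙ x) ≤ ℓ x → ι s ∙ x ≤ᴮ x
  ι∙-≤ᴮ s x le = ≤ᴮ-resp refl (ι-cancelˡ s x) (⟶⇒≤ᴮ (⟶-ι∙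
    (≡.subst (ℓ (ι s ∙ x) <_) (ℓ-cong (sym (ι-cancelˡ s x))) (ℓ-ι∙≤⇒< s x le))))

  ≤ᴮ-ι∙ : ∀ s x → ℓ x ≤ ℓ (ι s ∙ x) → x ≤ᴮ ι s ∙ x
  ≤ᴮ-ι∙ s x le = ≤ᴮ-resp (ι-cancelˡ s x) refl (ι∙-≤ᴮ s (ι s ∙ x)
    (≡.subst (_≤ ℓ (ι s ∙ x)) (ℓ-cong (sym (ι-cancelˡ s x))) le))

  -- Moves t to the left of sx, the side on which `exchange` acts.
  conj-ι∙ : ∀ {s t x y} → y ≈ x ∙ t → (ι s ∙ x) ∙ t ∙ (ι s ∙ x) ⁻¹ ∙ ⟦ s ∷ word x ⟧ ≈ ι s ∙ y
  conj-ι∙ {s} {t} {x} {y} y≈xt = begin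
    (ι s ∙ x) ∙ t ∙ (ι s ∙ x) ⁻¹ ∙ (ι s ∙ ⟦ word x ⟧)  ≈⟨ ∙-congˡ (∙-congˡ (⟦word⟧ x)) ⟩
    (ι s ∙ x) ∙ t ∙ (ι s ∙ x) ⁻¹ ∙ (ι s ∙ x)           ≈⟨ cancelʳ (inverseˡ _) _ ⟩
    (ι s ∙ x) ∙ t                                      ≈⟨ assoc _ _ _ ⟩
    ι s ∙ (x ∙ t)                                      ≈⟨ ∙-congˡ y≈xt ⟨
    ι s ∙ y                                            ∎

  -- Unless sx = y, the reflection relating x and y relates sx and sy in the
  -- same direction: otherwise exchange deletes a letter from s∷u, where u is a
  -- reduced word of x, and deleting one of u would make y shorter than x.
  ι∙-⟶ : ∀ {x y} s → x ⟶ y → ι s ∙ x ≈ y ⊎ ι s ∙ x ⟶ ι s ∙ y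
  ι∙-⟶ {x} {y} s (t , t-refl , y≈xt , ℓx<ℓy) with ℓ (ι s ∙ y) ℕ.≤? ℓ (ι s ∙ x)
  ... | no  nle = inj₂ (t , t-refl , trans (∙-congˡ y≈xt) (sym (assoc _ _ _)) , ℕ.≰⇒> nle)
  ... | yes le with exchange (s ∷ word x) (conj-reflection (ι s ∙ x) t-refl)
                      (≡.subst₂ _≤_ (ℓ-cong (sym (conj-ι∙ y≈xt))) (ℓ-cong (∙-congˡ (sym (⟦word⟧ x)))) le)
  ...   | i , eq = removed i (trans eq (conj-ι∙ y≈xt))
    where
    removed : (i : Fin (suc (length (word x)))) → ⟦ removeAt (s ∷ word x) i ⟧ ≈ ι s ∙ y →
              ι s ∙ x ≈ y ⊎ ι s ∙ x ⟶ ι s ∙ y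
    removed zero    eq = inj₁ (trans (∙-congˡ (trans (sym (⟦word⟧ x)) eq)) (ι-cancelˡ s y))
    removed (suc i) eq = contradiction (≡.subst₂ _<_ (ℓ-cong (∙-cancelˡ _ _ _ eq)) (length-word x)
      (⟦removeAt⟧-ℓ (word x) i)) (ℕ.<-asym ℓx<ℓy)

  -- The lifting property, with no descent assumed. Multiply a chain from x to y by s: either every
  -- arrow survives, or at the first failing arrow the multiplied chain lands on the original one,
  -- whose remainder leads to y. `ι∙-colift` reads the same collision as x = sz.
  ι∙-lift : ∀ {x y} s → x ≤ᴮ y → ι s ∙ x ≤ᴮ y ⊎ ι s ∙ x ≤ᴮ ι s ∙ y
  ι∙-lift s []⋆ = inj₂ ≤ᴮ-refl
  ι∙-lift s (inj₁ x≈z ◅ z≤y) with ι∙-lift s z≤y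
  ... | inj₁ sz≤y  = inj₁ (≤ᴮ-resp (∙-congˡ (sym x≈z)) refl sz≤y)
  ... | inj₂ sz≤sy = inj₂ (≤ᴮ-resp (∙-congˡ (sym x≈z)) refl sz≤sy)
  ι∙-lift s (inj₂ x⟶z ◅ z≤y) with ι∙-⟶ s x⟶z
  ... | inj₁ sx≈z  = inj₁ (≤ᴮ-resp (sym sx≈z) refl z≤y)
  ... | inj₂ sx⟶sz with ι∙-lift s z≤y
  ...   | inj₁ sz≤y  = inj₁ (≤ᴮ-trans (⟶⇒≤ᴮ sx⟶sz) sz≤y)
  ...   | inj₂ sz≤sy = inj₂ (≤ᴮ-trans (⟶⇒≤ᴮ sx⟶sz) sz≤sy)

  ι∙-colift : ∀ {x y} s → x ≤ᴮ y → x ≤ᴮ ι s ∙ y ⊎ ι s ∙ x ≤ᴮ ι s ∙ y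
  ι∙-colift s []⋆ = inj₂ ≤ᴮ-refl
  ι∙-colift s (inj₁ x≈z ◅ z≤y) with ι∙-colift s z≤y
  ... | inj₁ z≤sy  = inj₁ (≤ᴮ-resp (sym x≈z) refl z≤sy)
  ... | inj₂ sz≤sy = inj₂ (≤ᴮ-resp (∙-congˡ (sym x≈z)) refl sz≤sy)
  ι∙-colift s (inj₂ x⟶z ◅ z≤y) with ι∙-colift s z≤y
  ... | inj₁ z≤sy = inj₁ (≤ᴮ-trans (⟶⇒≤ᴮ x⟶z) z≤sy)
  ... | inj₂ sz≤sy with ι∙-⟶ s x⟶z
  ...   | inj₁ sx≈z  = inj₁ (≤ᴮ-resp (trans (∙-congˡ (sym sx≈z)) (ι-cancelˡ s _)) refl sz≤sy)
  ...   | inj₂ sx⟶sz = inj₂ (≤ᴮ-trans (⟶⇒≤ᴮ sx⟶sz) sz≤sy)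

  ι∙≤ᴮ-descent : ∀ {x y} s → ℓ (ι s ∙ y) ≤ ℓ y → x ≤ᴮ y → ι s ∙ x ≤ᴮ y
  ι∙≤ᴮ-descent s le x≤y with ι∙-lift s x≤y
  ... | inj₁ sx≤y  = sx≤y
  ... | inj₂ sx≤sy = ≤ᴮ-trans sx≤sy (ι∙-≤ᴮ s _ le)

  ≤ᴮι∙-ascent : ∀ {x y} s → ℓ x ≤ ℓ (ι s ∙ x) → x ≤ᴮ y → x ≤ᴮ ι s ∙ y
  ≤ᴮι∙-ascent s le x≤y with ι∙-colift s x≤y
  ... | inj₁ x≤sy  = x≤sy
  ... | inj₂ sx≤sy = ≤ᴮ-trans (≤ᴮ-ι∙ s _ le) sx≤sy

  -- (xt)⁻¹ = x⁻¹(xtx⁻¹), so arrows invert to arrows. This transfers the left-handed lifting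
  -- statements to the right.
  ≤ᴮ-⁻¹ : ∀ {x y} → x ≤ᴮ y → x ⁻¹ ≤ᴮ y ⁻¹
  ≤ᴮ-⁻¹ []⋆ = []⋆
  ≤ᴮ-⁻¹ (inj₁ x≈z ◅ z≤y) = inj₁ (⁻¹-cong x≈z) ◅ ≤ᴮ-⁻¹ z≤y
  ≤ᴮ-⁻¹ (inj₂ (t , t-refl , z≈xt , ℓx<ℓz) ◅ z≤y) =
    inj₂ (_ , conj-reflection _ t-refl , z⁻¹≈ , ≡.subst₂ _<_ (≡.sym (ℓ-⁻¹ _)) (≡.sym (ℓ-⁻¹ _)) ℓx<ℓz) ◅ ≤ᴮ-⁻¹ z≤y
    where
    t⁻¹≈t = sym (inverseˡ-unique _ _ (reflection² t-refl))
    z⁻¹≈ = trans (⁻¹-cong z≈xt) (trans (⁻¹-anti-homo-∙ _ _) (trans (∙-congʳ t⁻¹≈t)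
      (sym (trans (∙-congˡ (∙-congˡ (⁻¹-involutive _))) (∙-conj _ t)))))

  ∙ι≤ᴮ-descent : ∀ {x y} s → ℓ (y ∙ ι s) ≤ ℓ y → x ≤ᴮ y → x ∙ ι s ≤ᴮ y
  ∙ι≤ᴮ-descent {x} {y} s le x≤y = ≤ᴮ-resp
    (trans (⁻¹-cong (sym (ι∙-⁻¹ s x))) (⁻¹-involutive _)) (⁻¹-involutive _)
    (≤ᴮ-⁻¹ (ι∙≤ᴮ-descent s (≡.subst₂ _≤_ (ℓ-∙ι s y) (≡.sym (ℓ-⁻¹ y)) le) (≤ᴮ-⁻¹ x≤y)))

  ≤ᴮ∙ι-ascent : ∀ {x y} s → ℓ x ≤ ℓ (x ∙ ι s) → x ≤ᴮ y → x ≤ᴮ y ∙ ι s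
  ≤ᴮ∙ι-ascent {x} {y} s le x≤y = ≤ᴮ-resp
    (⁻¹-involutive _) (trans (⁻¹-cong (sym (ι∙-⁻¹ s y))) (⁻¹-involutive _))
    (≤ᴮ-⁻¹ (≤ᴮι∙-ascent s (≡.subst₂ _≤_ (≡.sym (ℓ-⁻¹ x)) (ℓ-∙ι s x) le) (≤ᴮ-⁻¹ x≤y)))

  -- The *-product

  *ˢ-up : ∀ s x → ℓ x < ℓ (ι s ∙ x) → s *ˢ x ≈ ι s ∙ x
  *ˢ-up s x lt with ℓ x ℕ.<? ℓ (ι s ∙ x)
  ... | yes _   = refl
  ... | no  nlt = contradiction lt nlt

  *ˢ-down : ∀ s x → ℓ (ι s ∙ x) ≤ ℓ x → s *ˢ x ≈ x
  *ˢ-down s x le with ℓ x ℕ.<? ℓ (ι s ∙ x)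
  ... | yes lt = contradiction lt (ℕ.≤⇒≯ le)
  ... | no  _  = refl

  *ˢ-cong : ∀ s {x y} → x ≈ y → s *ˢ x ≈ s *ˢ y
  *ˢ-cong s {x} {y} x≈y with ℓ x ℕ.<? ℓ (ι s ∙ x)
  ... | yes lt = trans (∙-congˡ x≈y) (sym (*ˢ-up s y (≡.subst₂ _<_ (ℓ-cong x≈y) (ℓ-cong (∙-congˡ x≈y)) lt)))
  ... | no nlt = trans x≈y (sym (*ˢ-down s y (≡.subst₂ _≤_ (ℓ-cong (∙-congˡ x≈y)) (ℓ-cong x≈y) (ℕ.≮⇒≥ nlt))))

  infixl 7 _*ʳ_
  _*ʳ_ : Carrier → S → Carrier
  x *ʳ s with ℓ x ℕ.<? ℓ (x ∙ ι s)
  ... | yes _ = x ∙ ι s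
  ... | no  _ = x

  *ʳ-up : ∀ s x → ℓ x < ℓ (x ∙ ι s) → x *ʳ s ≈ x ∙ ι s
  *ʳ-up s x lt with ℓ x ℕ.<? ℓ (x ∙ ι s)
  ... | yes _   = refl
  ... | no  nlt = contradiction lt nlt

  *ʳ-down : ∀ s x → ℓ (x ∙ ι s) ≤ ℓ x → x *ʳ s ≈ x
  *ʳ-down s x le with ℓ x ℕ.<? ℓ (x ∙ ι s)
  ... | yes lt = contradiction lt (ℕ.≤⇒≯ le)
  ... | no  _  = refl

  *ʳ-cong : ∀ s {x y} → x ≈ y → x *ʳ s ≈ y *ʳ s
  *ʳ-cong s {x} {y} x≈y with ℓ x ℕ.<? ℓ (x ∙ ι s)
  ... | yes lt = trans (∙-congʳ x≈y) (sym (*ʳ-up s y (≡.subst₂ _<_ (ℓ-cong x≈y) (ℓ-cong (∙-congʳ x≈y)) lt)))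
  ... | no nlt = trans x≈y (sym (*ʳ-down s y (≡.subst₂ _≤_ (ℓ-cong (∙-congʳ x≈y)) (ℓ-cong x≈y) (ℕ.≮⇒≥ nlt))))

  ℓ-∙ι≤⇒< : ∀ s x → ℓ (x ∙ ι s) ≤ ℓ x → ℓ (x ∙ ι s) < ℓ x
  ℓ-∙ι≤⇒< s x le = ≡.subst₂ _<_ (≡.sym (ℓ-∙ι s x)) (ℓ-⁻¹ x)
    (ℓ-ι∙≤⇒< s (x ⁻¹) (≡.subst₂ _≤_ (ℓ-∙ι s x) (≡.sym (ℓ-⁻¹ x)) le))

  ℓ-∙ι≤ : ∀ s x → ℓ (x ∙ ι s) ≤ suc (ℓ x)
  ℓ-∙ι≤ s x = ≡.subst₂ _≤_ (≡.sym (ℓ-∙ι s x)) (≡.cong suc (ℓ-⁻¹ x)) (ℓ-ι∙ s (x ⁻¹))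

  -- If exactly one side is an ascent, the other side stays a descent after that ascent is applied,
  -- by comparing lengths. If both are ascents, either sx = xt and both products equal this element,
  -- or sx < sxt and both equal sxt.
  *ˢ-*ʳ-assoc : ∀ s x t → s *ˢ (x *ʳ t) ≈ (s *ˢ x) *ʳ t
  *ˢ-*ʳ-assoc s x t with ℓ x ℕ.<? ℓ (ι s ∙ x) | ℓ x ℕ.<? ℓ (x ∙ ι t)
  ... | no sx≮ | no xt≮ = trans (*ˢ-down s x (ℕ.≮⇒≥ sx≮)) (sym (*ʳ-down t x (ℕ.≮⇒≥ xt≮)))
  ... | no sx≮ | yes xt = trans (*ˢ-down s (x ∙ ι t) down) (sym (*ʳ-up t x xt))
    where
    down : ℓ (ι s ∙ (x ∙ ι t)) ≤ ℓ (x ∙ ι t)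
    down = ℕ.≤-trans (ℕ.≤-reflexive (ℓ-cong (sym (assoc _ _ _))))
      (ℕ.≤-trans (ℓ-∙ι≤ t (ι s ∙ x)) (ℕ.≤-trans (ℓ-ι∙≤⇒< s x (ℕ.≮⇒≥ sx≮)) (ℕ.<⇒≤ xt)))
  ... | yes sx | no xt≮ = trans (*ˢ-up s x sx) (sym (*ʳ-down t (ι s ∙ x) down))
    where
    down : ℓ (ι s ∙ x ∙ ι t) ≤ ℓ (ι s ∙ x)
    down = ℕ.≤-trans (ℕ.≤-reflexive (ℓ-cong (assoc _ _ _)))
      (ℕ.≤-trans (ℓ-ι∙ s (x ∙ ι t)) (ℕ.≤-trans (ℓ-∙ι≤⇒< t x (ℕ.≮⇒≥ xt≮)) (ℕ.<⇒≤ sx)))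
  ... | yes sx | yes xt with ι∙-⟶ s (⟶-∙ι xt)
  ...   | inj₁ sx≈xt = trans (*ˢ-down s (x ∙ ι t) downˡ)
      (trans (sym sx≈xt) (sym (*ʳ-down t (ι s ∙ x) downʳ)))
    where
    downˡ : ℓ (ι s ∙ (x ∙ ι t)) ≤ ℓ (x ∙ ι t)
    downˡ = ℕ.≤-trans (ℕ.≤-reflexive (ℓ-cong (trans (∙-congˡ (sym sx≈xt)) (ι-cancelˡ s x)))) (ℕ.<⇒≤ xt)
    downʳ : ℓ (ι s ∙ x ∙ ι t) ≤ ℓ (ι s ∙ x)
    downʳ = ℕ.≤-trans (ℕ.≤-reflexive (ℓ-cong (trans (∙-congʳ sx≈xt) (ι-cancelʳ t x)))) (ℕ.<⇒≤ sx)
  ...   | inj₂ (_ , _ , _ , sx<sxt) = trans (*ˢ-up s (x ∙ ι t) upˡ)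
      (trans (sym (assoc _ _ _)) (sym (*ʳ-up t (ι s ∙ x) (≡.subst (ℓ (ι s ∙ x) <_) (ℓ-cong (sym (assoc _ _ _))) sx<sxt))))
    where
    upˡ : ℓ (x ∙ ι t) < ℓ (ι s ∙ (x ∙ ι t))
    upˡ = ℕ.≤-<-trans (ℓ-∙ι≤ t x) (ℕ.≤-<-trans sx sx<sxt)

  infixr 7 _⋆_
  _⋆_ : List S → Carrier → Carrier
  u ⋆ x = foldr _*ˢ_ x u

  infixl 7 _⋆ʳ_
  _⋆ʳ_ : Carrier → List S → Carrier
  x ⋆ʳ u = foldl _*ʳ_ x u

  ⋆-cong : ∀ u {x y} → x ≈ y → u ⋆ x ≈ u ⋆ y
  ⋆-cong []      x≈y = x≈y
  ⋆-cong (s ∷ u) x≈y = *ˢ-cong s (⋆-cong u x≈y)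

  ⋆ʳ-cong : ∀ u {x y} → x ≈ y → x ⋆ʳ u ≈ y ⋆ʳ u
  ⋆ʳ-cong []      x≈y = x≈y
  ⋆ʳ-cong (s ∷ u) x≈y = ⋆ʳ-cong u (*ʳ-cong s x≈y)

  *ˢ-⋆ʳ-assoc : ∀ s x v → s *ˢ (x ⋆ʳ v) ≈ (s *ˢ x) ⋆ʳ v
  *ˢ-⋆ʳ-assoc s x []      = refl
  *ˢ-⋆ʳ-assoc s x (t ∷ v) = trans (*ˢ-⋆ʳ-assoc s (x *ʳ t) v) (⋆ʳ-cong v (*ˢ-*ʳ-assoc s x t))

  ⋆-⋆ʳ-assoc : ∀ u x v → u ⋆ (x ⋆ʳ v) ≈ (u ⋆ x) ⋆ʳ v
  ⋆-⋆ʳ-assoc []      x v = refl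
  ⋆-⋆ʳ-assoc (s ∷ u) x v = trans (*ˢ-cong s (⋆-⋆ʳ-assoc u x v)) (*ˢ-⋆ʳ-assoc s (u ⋆ x) v)

  ℓ-⟦⟧∙ : ∀ u x → ℓ (⟦ u ⟧ ∙ x) ≤ length u ℕ.+ ℓ x
  ℓ-⟦⟧∙ u x = ℕ.≤-trans (ℓ-∙ ⟦ u ⟧ x) (ℕ.+-monoˡ-≤ (ℓ x) (ℓ-⟦⟧ u))

  ℓ-∙⟦⟧ : ∀ x u → ℓ (x ∙ ⟦ u ⟧) ≤ ℓ x ℕ.+ length u
  ℓ-∙⟦⟧ x u = ℕ.≤-trans (ℓ-∙ x ⟦ u ⟧) (ℕ.+-monoʳ-≤ (ℓ x) (ℓ-⟦⟧ u))

  -- Additivity passes to the tail and forces each letter to raise the length, so every `_*ˢ_` is a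
  -- genuine multiplication.
  ⋆-additive : ∀ u x → length u ℕ.+ ℓ x ≤ ℓ (⟦ u ⟧ ∙ x) → u ⋆ x ≈ ⟦ u ⟧ ∙ x
  ⋆-additive []      x le = sym (identityˡ x)
  ⋆-additive (s ∷ u) x le = begin
    s *ˢ (u ⋆ x)           ≈⟨ *ˢ-cong s (⋆-additive u x le′) ⟩
    s *ˢ (⟦ u ⟧ ∙ x)       ≈⟨ *ˢ-up s _ (ℕ.≤-trans (s≤s (ℓ-⟦⟧∙ u x)) le″) ⟩
    ι s ∙ (⟦ u ⟧ ∙ x)      ≈⟨ assoc _ _ _ ⟨
    ι s ∙ ⟦ u ⟧ ∙ x        ∎
    where
    le″ : suc (length u ℕ.+ ℓ x) ≤ ℓ (ι s ∙ (⟦ u ⟧ ∙ x))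
    le″ = ≡.subst (suc (length u ℕ.+ ℓ x) ≤_) (ℓ-cong (assoc _ _ _)) le
    le′ : length u ℕ.+ ℓ x ≤ ℓ (⟦ u ⟧ ∙ x)
    le′ = ℕ.s≤s⁻¹ (ℕ.≤-trans le″ (ℓ-ι∙ s _))

  ⋆ʳ-additive : ∀ x u → ℓ x ℕ.+ length u ≤ ℓ (x ∙ ⟦ u ⟧) → x ⋆ʳ u ≈ x ∙ ⟦ u ⟧
  ⋆ʳ-additive x []      le = sym (identityʳ x)
  ⋆ʳ-additive x (s ∷ u) le = begin
    (x *ʳ s) ⋆ʳ u          ≈⟨ ⋆ʳ-cong u (*ʳ-up s x ℓx<ℓxs) ⟩
    (x ∙ ι s) ⋆ʳ u         ≈⟨ ⋆ʳ-additive (x ∙ ι s) u (ℕ.≤-trans (ℕ.+-monoˡ-≤ (length u) (ℓ-∙ι≤ s x)) le′) ⟩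
    x ∙ ι s ∙ ⟦ u ⟧        ≈⟨ assoc _ _ _ ⟩
    x ∙ (ι s ∙ ⟦ u ⟧)      ∎
    where
    le′ : suc (ℓ x ℕ.+ length u) ≤ ℓ (x ∙ ι s ∙ ⟦ u ⟧)
    le′ = ≡.subst₂ _≤_ (ℕ.+-suc (ℓ x) (length u)) (ℓ-cong (sym (assoc _ _ _))) le
    ℓx<ℓxs : ℓ x < ℓ (x ∙ ι s)
    ℓx<ℓxs = ℕ.+-cancelʳ-≤ (length u) (suc (ℓ x)) (ℓ (x ∙ ι s)) (ℕ.≤-trans le′ (ℓ-∙⟦⟧ (x ∙ ι s) u))

  ⋆-reduced : ∀ u → length u ≤ ℓ ⟦ u ⟧ → u ⋆ ε ≈ ⟦ u ⟧
  ⋆-reduced u le = trans (⋆-additive u ε (≡.subst₂ _≤_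
      (≡.trans (≡.sym (ℕ.+-identityʳ _)) (≡.cong (length u ℕ.+_) (≡.sym ℓ-ε)))
      (ℓ-cong (sym (identityʳ _))) le))
    (identityʳ _)

  ε-⋆ʳ-word : ∀ x → ε ⋆ʳ word x ≈ x
  ε-⋆ʳ-word x = trans (⋆ʳ-additive ε (word x) (ℕ.≤-reflexive
      (≡.trans (≡.cong₂ ℕ._+_ ℓ-ε (length-word x)) (ℓ-cong (trans (sym (⟦word⟧ x)) (sym (identityˡ _)))))))
    (trans (identityˡ _) (⟦word⟧ x))

  -- Left and right multiplications commute, so both v * w = s₁ * (⋯ * (sₖ * w))
  -- and v * w = (v * t₁) * ⋯ * tₙ hold for reduced words of v and w.
  ⋆≈⋆ʳ : ∀ u {x} y → length u ≤ ℓ ⟦ u ⟧ → ⟦ u ⟧ ≈ x → u ⋆ y ≈ x ⋆ʳ word y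
  ⋆≈⋆ʳ u {x} y red u≈x = begin
    u ⋆ y                    ≈⟨ ⋆-cong u (ε-⋆ʳ-word y) ⟨
    u ⋆ (ε ⋆ʳ word y)        ≈⟨ ⋆-⋆ʳ-assoc u ε (word y) ⟩
    (u ⋆ ε) ⋆ʳ word y        ≈⟨ ⋆ʳ-cong (word y) (trans (⋆-reduced u red) u≈x) ⟩
    x ⋆ʳ word y              ∎

  *≈⋆ʳ : ∀ x y → x * y ≈ x ⋆ʳ word y
  *≈⋆ʳ x y = ⋆≈⋆ʳ (word x) y (ℕ.≤-reflexive (≡.trans (length-word x) (ℓ-cong (sym (⟦word⟧ x))))) (⟦word⟧ x)

  *≈⋆ : ∀ u {x} y → length u ≤ ℓ ⟦ u ⟧ → ⟦ u ⟧ ≈ x → x * y ≈ u ⋆ y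
  *≈⋆ u {x} y red u≈x = trans (*≈⋆ʳ x y) (sym (⋆≈⋆ʳ u y red u≈x))

  *-congˡ : ∀ x {y z} → y ≈ z → x * y ≈ x * z
  *-congˡ x = ⋆-cong (word x)

  *-congʳ : ∀ z {x y} → x ≈ y → x * z ≈ y * z
  *-congʳ z {x} {y} x≈y = trans (*≈⋆ʳ x z) (trans (⋆ʳ-cong (word z) x≈y) (sym (*≈⋆ʳ y z)))

  *-assoc : ∀ x y z → (x * y) * z ≈ x * (y * z)
  *-assoc x y z = begin
    (x * y) * z               ≈⟨ *≈⋆ʳ (x * y) z ⟩
    (word x ⋆ y) ⋆ʳ word z    ≈⟨ ⋆-⋆ʳ-assoc (word x) y (word z) ⟨
    word x ⋆ (y ⋆ʳ word z)    ≈⟨ ⋆-cong (word x) (*≈⋆ʳ y z) ⟨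
    x * (y * z)               ∎

  *-additive : ∀ x y → ℓ x ℕ.+ ℓ y ≤ ℓ (x ∙ y) → x * y ≈ x ∙ y
  *-additive x y le = trans (⋆-additive (word x) y (≡.subst₂ _≤_ (≡.cong (ℕ._+ ℓ y) (≡.sym (length-word x)))
      (ℓ-cong (∙-congʳ (sym (⟦word⟧ x)))) le))
    (∙-congʳ (⟦word⟧ x))

  ℓ-*ˢ : ∀ s x → ℓ (s *ˢ x) ≤ suc (ℓ x)
  ℓ-*ˢ s x with ℓ x ℕ.<? ℓ (ι s ∙ x)
  ... | yes _ = ℓ-ι∙ s x
  ... | no  _ = ℕ.n≤1+n (ℓ x)

  ℓ-⋆ : ∀ u x → ℓ (u ⋆ x) ≤ length u ℕ.+ ℓ x
  ℓ-⋆ []      x = ℕ.≤-refl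
  ℓ-⋆ (s ∷ u) x = ℕ.≤-trans (ℓ-*ˢ s (u ⋆ x)) (s≤s (ℓ-⋆ u x))

  ℓ-* : ∀ x y → ℓ (x * y) ≤ ℓ x ℕ.+ ℓ y
  ℓ-* x y = ≡.subst (λ n → ℓ (x * y) ≤ n ℕ.+ ℓ y) (length-word x) (ℓ-⋆ (word x) y)

  x≤ᴮs*ˢx : ∀ s x → x ≤ᴮ s *ˢ x
  x≤ᴮs*ˢx s x with ℓ x ℕ.<? ℓ (ι s ∙ x)
  ... | yes lt = ⟶⇒≤ᴮ (⟶-ι∙ lt)
  ... | no  _  = ≤ᴮ-refl

  *ˢ-descent : ∀ s x → ℓ (ι s ∙ (s *ˢ x)) ≤ ℓ (s *ˢ x)
  *ˢ-descent s x with ℓ x ℕ.<? ℓ (ι s ∙ x)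
  ... | yes lt  = ℕ.≤-trans (ℕ.≤-reflexive (ℓ-cong (ι-cancelˡ s x))) (ℕ.<⇒≤ lt)
  ... | no  nlt = ℕ.≮⇒≥ nlt

  -- `s *ˢ y` lies above x and has s as a descent, so lifting brings sx below it as well.
  *ˢ-mono : ∀ s {x y} → x ≤ᴮ y → s *ˢ x ≤ᴮ s *ˢ y
  *ˢ-mono s {x} {y} x≤y with ℓ x ℕ.<? ℓ (ι s ∙ x)
  ... | yes _ = ι∙≤ᴮ-descent s (*ˢ-descent s y) (≤ᴮ-trans x≤y (x≤ᴮs*ˢx s y))
  ... | no  _ = ≤ᴮ-trans x≤y (x≤ᴮs*ˢx s y)

  x≤ᴮx*ʳs : ∀ s x → x ≤ᴮ x *ʳ s
  x≤ᴮx*ʳs s x with ℓ x ℕ.<? ℓ (x ∙ ι s)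
  ... | yes lt = ⟶⇒≤ᴮ (⟶-∙ι lt)
  ... | no  _  = ≤ᴮ-refl

  *ʳ-descent : ∀ s x → ℓ ((x *ʳ s) ∙ ι s) ≤ ℓ (x *ʳ s)
  *ʳ-descent s x with ℓ x ℕ.<? ℓ (x ∙ ι s)
  ... | yes lt  = ℕ.≤-trans (ℕ.≤-reflexive (ℓ-cong (ι-cancelʳ s x))) (ℕ.<⇒≤ lt)
  ... | no  nlt = ℕ.≮⇒≥ nlt

  *ʳ-mono : ∀ s {x y} → x ≤ᴮ y → x *ʳ s ≤ᴮ y *ʳ s
  *ʳ-mono s {x} {y} x≤y with ℓ x ℕ.<? ℓ (x ∙ ι s)
  ... | yes _ = ∙ι≤ᴮ-descent s (*ʳ-descent s y) (≤ᴮ-trans x≤y (x≤ᴮx*ʳs s y))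
  ... | no  _ = ≤ᴮ-trans x≤y (x≤ᴮx*ʳs s y)

  ⋆-mono : ∀ u {x y} → x ≤ᴮ y → u ⋆ x ≤ᴮ u ⋆ y
  ⋆-mono []      x≤y = x≤y
  ⋆-mono (s ∷ u) x≤y = *ˢ-mono s (⋆-mono u x≤y)

  ⋆ʳ-mono : ∀ u {x y} → x ≤ᴮ y → x ⋆ʳ u ≤ᴮ y ⋆ʳ u
  ⋆ʳ-mono []      x≤y = x≤y
  ⋆ʳ-mono (s ∷ u) x≤y = ⋆ʳ-mono u (*ʳ-mono s x≤y)

  *-monoʳ : ∀ x {y z} → y ≤ᴮ z → x * y ≤ᴮ x * z
  *-monoʳ x = ⋆-mono (word x)

  *-monoˡ : ∀ x {y z} → y ≤ᴮ z → y * x ≤ᴮ z * x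
  *-monoˡ x {y} {z} y≤z = ≤ᴮ-resp (sym (*≈⋆ʳ y x)) (sym (*≈⋆ʳ z x)) (⋆ʳ-mono (word x) y≤z)

  -- Parabolic subgroups and double cosets

  Parabolic-ε : ∀ {I} → ε ∈ Parabolic I
  Parabolic-ε = [] , [] , refl

  Parabolic-ι : ∀ {I s} → s ∈ I → ι s ∈ Parabolic I
  Parabolic-ι s∈I = _ ∷ [] , s∈I ∷ [] , identityʳ _

  Parabolic-∙ : ∀ {I x y} → x ∈ Parabolic I → y ∈ Parabolic I → x ∙ y ∈ Parabolic I
  Parabolic-∙ (u , u⊆I , u≈x) (v , v⊆I , v≈y) =
    u ++ v , ++⁺ u⊆I v⊆I , trans (⟦⟧-++ u v) (∙-cong u≈x v≈y)

  All-reverse : ∀ {I : Pred S a} {u} → All I u → All I (reverse u)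
  All-reverse []                      = []
  All-reverse {u = s ∷ u} (s∈I ∷ u⊆I) =
    ≡.subst (All _) (≡.sym (unfold-reverse s u)) (++⁺ (All-reverse u⊆I) (s∈I ∷ []))

  Parabolic-⁻¹ : ∀ {I x} → x ∈ Parabolic I → x ⁻¹ ∈ Parabolic I
  Parabolic-⁻¹ (u , u⊆I , u≈x) =
    reverse u , All-reverse u⊆I , trans (⟦reverse⟧ u) (⁻¹-cong u≈x)

  Parabolic-resp : ∀ {I J x} → (∀ {s} → s ∈ I → s ∈ J) → x ∈ Parabolic I → x ∈ Parabolic J
  Parabolic-resp I⊆J (u , u⊆I , u≈x) = u , All.map I⊆J u⊆I , u≈x

  -- Conditions on single generators; lifting upgrades them to extremality in the Bruhat order over
  -- a whole double coset.
  LeftMax RightMax LeftMin RightMin : FinitarySubset → Pred Carrier a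
  LeftMax  I x = ∀ {s} → s ∈ subset I → ℓ (ι s ∙ x) ≤ ℓ x
  RightMax I x = ∀ {s} → s ∈ subset I → ℓ (x ∙ ι s) ≤ ℓ x
  LeftMin  I x = ∀ {s} → s ∈ subset I → ℓ x ≤ ℓ (ι s ∙ x)
  RightMin I x = ∀ {s} → s ∈ subset I → ℓ x ≤ ℓ (x ∙ ι s)

  Max Min : FinitarySubset → FinitarySubset → Pred Carrier a
  Max I J x = LeftMax I x × RightMax J x
  Min I J x = LeftMin I x × RightMin J x

  -- A left descent s of x is absorbed, s * x = x, and associativity passes this on to x * y.
  *-leftMax : ∀ {I x} y → LeftMax I x → LeftMax I (x * y)
  *-leftMax {x = x} y x-max {s} s∈I = ≡.subst₂ _≤_ (ℓ-cong (∙-congˡ fixed)) (ℓ-cong fixed) (*ˢ-descent s (x * y))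
    where
    fixed : s *ˢ (x * y) ≈ x * y
    fixed = begin
      s *ˢ (x * y)             ≈⟨ *ˢ-cong s (*≈⋆ʳ x y) ⟩
      s *ˢ (x ⋆ʳ word y)       ≈⟨ *ˢ-⋆ʳ-assoc s x (word y) ⟩
      (s *ˢ x) ⋆ʳ word y       ≈⟨ ⋆ʳ-cong (word y) (*ˢ-down s x (x-max s∈I)) ⟩
      x ⋆ʳ word y              ≈⟨ *≈⋆ʳ x y ⟨
      x * y                    ∎

  *-rightMax : ∀ {I} x {y} → RightMax I y → RightMax I (x * y)
  *-rightMax x {y} y-max {s} s∈I = ≡.subst₂ _≤_ (ℓ-cong (∙-congʳ fixed)) (ℓ-cong fixed) (*ʳ-descent s (x * y))
    where
    fixed : (x * y) *ʳ s ≈ x * y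
    fixed = trans (sym (⋆-⋆ʳ-assoc (word x) y (s ∷ []))) (⋆-cong (word x) (*ʳ-down s y (y-max s∈I)))

  ⟦⟧∙≤ᴮ : ∀ {I x z} u → All (subset I) u → LeftMax I z → x ≤ᴮ z → ⟦ u ⟧ ∙ x ≤ᴮ z
  ⟦⟧∙≤ᴮ []      []          z-max x≤z = ≤ᴮ-resp (sym (identityˡ _)) refl x≤z
  ⟦⟧∙≤ᴮ {I} (s ∷ u) (s∈I ∷ u⊆I) z-max x≤z =
    ≤ᴮ-resp (sym (assoc _ _ _)) refl (ι∙≤ᴮ-descent s (z-max s∈I) (⟦⟧∙≤ᴮ {I} u u⊆I z-max x≤z))

  ∙⟦⟧≤ᴮ : ∀ {I x z} u → All (subset I) u → RightMax I z → x ≤ᴮ z → x ∙ ⟦ u ⟧ ≤ᴮ z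
  ∙⟦⟧≤ᴮ []      []          z-max x≤z = ≤ᴮ-resp (sym (identityʳ _)) refl x≤z
  ∙⟦⟧≤ᴮ {I} (s ∷ u) (s∈I ∷ u⊆I) z-max x≤z =
    ≤ᴮ-resp (assoc _ _ _) refl (∙⟦⟧≤ᴮ {I} u u⊆I z-max (∙ι≤ᴮ-descent s (z-max s∈I) x≤z))

  ≤ᴮ⟦⟧∙ : ∀ {I x z} u → All (subset I) u → LeftMin I z → z ≤ᴮ x → z ≤ᴮ ⟦ u ⟧ ∙ x
  ≤ᴮ⟦⟧∙ []      []          z-min z≤x = ≤ᴮ-resp refl (sym (identityˡ _)) z≤x
  ≤ᴮ⟦⟧∙ {I} (s ∷ u) (s∈I ∷ u⊆I) z-min z≤x =
    ≤ᴮ-resp refl (sym (assoc _ _ _)) (≤ᴮι∙-ascent s (z-min s∈I) (≤ᴮ⟦⟧∙ {I} u u⊆I z-min z≤x))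

  ≤ᴮ∙⟦⟧ : ∀ {I x z} u → All (subset I) u → RightMin I z → z ≤ᴮ x → z ≤ᴮ x ∙ ⟦ u ⟧
  ≤ᴮ∙⟦⟧ []      []          z-min z≤x = ≤ᴮ-resp refl (sym (identityʳ _)) z≤x
  ≤ᴮ∙⟦⟧ {I} (s ∷ u) (s∈I ∷ u⊆I) z-min z≤x =
    ≤ᴮ-resp refl (assoc _ _ _) (≤ᴮ∙⟦⟧ {I} u u⊆I z-min (≤ᴮ∙ι-ascent s (z-min s∈I) z≤x))

  module _ {I J : FinitarySubset} where

    coset-refl : ∀ x → x ∈ elems {I} {J} (coset x)
    coset-refl x = ε , ε , Parabolic-ε , Parabolic-ε , sym (trans (identityʳ _) (identityˡ x))

    coset-sym : ∀ {x y} → y ∈ elems {I} {J} (coset x) → x ∈ elems {I} {J} (coset y)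
    coset-sym {x} {y} (g , h , g∈W , h∈W , y≈gxh) = g ⁻¹ , h ⁻¹ , Parabolic-⁻¹ g∈W , Parabolic-⁻¹ h∈W , sym (begin
      g ⁻¹ ∙ y ∙ h ⁻¹              ≈⟨ ∙-congʳ (∙-congˡ (trans y≈gxh (assoc _ _ _))) ⟩
      g ⁻¹ ∙ (g ∙ (x ∙ h)) ∙ h ⁻¹  ≈⟨ ∙-congʳ (cancelˡ (inverseˡ g) _) ⟩
      x ∙ h ∙ h ⁻¹                 ≈⟨ cancelʳ (inverseʳ h) x ⟩
      x                            ∎)

    coset-trans : ∀ {x y z} → y ∈ elems {I} {J} (coset x) → z ∈ elems {I} {J} (coset y) → z ∈ elems {I} {J} (coset x)
    coset-trans {x} {y} {z} (g , h , g∈W , h∈W , y≈gxh) (g′ , h′ , g′∈W , h′∈W , z≈g′yh′) =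
      g′ ∙ g , h ∙ h′ , Parabolic-∙ g′∈W g∈W , Parabolic-∙ h∈W h′∈W , (begin
        z                            ≈⟨ z≈g′yh′ ⟩
        g′ ∙ y ∙ h′                  ≈⟨ ∙-congʳ (∙-congˡ y≈gxh) ⟩
        g′ ∙ (g ∙ x ∙ h) ∙ h′        ≈⟨ solve monoid ⟩
        (g′ ∙ g) ∙ x ∙ (h ∙ h′)      ∎)

    elems-resp : ∀ (p : Coset I J) {x y} → x ≈ y → x ∈ elems p → y ∈ elems p
    elems-resp p x≈y (g , h , g∈W , h∈W , x≈) = g , h , g∈W , h∈W , trans (sym x≈y) x≈

    elems-∙ : ∀ (p : Coset I J) {g x h} → x ∈ elems p → g ∈ W[ I ] → h ∈ W[ J ] → g ∙ x ∙ h ∈ elems p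
    elems-∙ p x∈p g∈W h∈W = coset-trans x∈p (_ , _ , g∈W , h∈W , refl)

    elems-∙ˡ : ∀ (p : Coset I J) {g x} → x ∈ elems p → g ∈ W[ I ] → g ∙ x ∈ elems p
    elems-∙ˡ p x∈p g∈W = elems-resp p (identityʳ _) (elems-∙ p x∈p g∈W Parabolic-ε)

    elems-∙ʳ : ∀ (p : Coset I J) {x h} → x ∈ elems p → h ∈ W[ J ] → x ∙ h ∈ elems p
    elems-∙ʳ p x∈p h∈W = elems-resp p (∙-congʳ (identityˡ _)) (elems-∙ p x∈p Parabolic-ε h∈W)

    common⇒≈ᶜ : ∀ (p q : Coset I J) {x} → x ∈ elems p → x ∈ elems q → p ≈ᶜ q
    common⇒≈ᶜ p q x∈p x∈q =
      (λ y∈p → coset-trans (coset-trans x∈q (coset-sym x∈p)) y∈p) ,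
      (λ y∈q → coset-trans (coset-trans x∈p (coset-sym x∈q)) y∈q)

    -- Any other element of p arises from x by letters of I on the left and J on the right; each
    -- such letter is a descent of z, so lifting keeps the result below z. As z may lie outside p,
    -- different cosets can be compared.
    elems-≤ᴮ : ∀ (p : Coset I J) {x y z} → x ∈ elems p → y ∈ elems p → Max I J z → x ≤ᴮ z → y ≤ᴮ z
    elems-≤ᴮ p x∈p y∈p (z-maxˡ , z-maxʳ) x≤z
      with coset-trans (coset-sym x∈p) y∈p
    ... | _ , _ , (u , u⊆I , u≈g) , (v , v⊆J , v≈h) , y≈gxh =
      ≤ᴮ-resp (trans (∙-cong (∙-congʳ u≈g) v≈h) (sym y≈gxh)) refl
        (∙⟦⟧≤ᴮ {J} v v⊆J z-maxʳ (⟦⟧∙≤ᴮ {I} u u⊆I z-maxˡ x≤z))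

    ≤ᴮ-elems : ∀ (p : Coset I J) {x y z} → x ∈ elems p → y ∈ elems p → Min I J z → z ≤ᴮ x → z ≤ᴮ y
    ≤ᴮ-elems p x∈p y∈p (z-minˡ , z-minʳ) z≤x
      with coset-trans (coset-sym x∈p) y∈p
    ... | _ , _ , (u , u⊆I , u≈g) , (v , v⊆J , v≈h) , y≈gxh =
      ≤ᴮ-resp refl (trans (∙-cong (∙-congʳ u≈g) v≈h) (sym y≈gxh))
        (≤ᴮ∙⟦⟧ {J} v v⊆J z-minʳ (≤ᴮ⟦⟧∙ {I} u u⊆I z-minˡ z≤x))

    longest⇒Max : ∀ (p : Coset I J) {x} → x ∈ elems p → (∀ {y} → y ∈ elems p → ℓ y ≤ ℓ x) → Max I J x
    longest⇒Max p x∈p bound =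
      (λ s∈I → bound (elems-∙ˡ p x∈p (Parabolic-ι s∈I))) , (λ s∈J → bound (elems-∙ʳ p x∈p (Parabolic-ι s∈J)))

    shortest⇒Min : ∀ (p : Coset I J) {x} → x ∈ elems p → (∀ {y} → y ∈ elems p → ℓ x ≤ ℓ y) → Min I J x
    shortest⇒Min p x∈p bound =
      (λ s∈I → bound (elems-∙ˡ p x∈p (Parabolic-ι s∈I))) , (λ s∈J → bound (elems-∙ʳ p x∈p (Parabolic-ι s∈J)))

    IsMax⇒Max : ∀ (p : Coset I J) {x} → IsMax p x → Max I J x
    IsMax⇒Max p (x∈p , bound) = longest⇒Max p x∈p (λ y∈p → ≤ᴮ⇒ℓ≤ (bound _ y∈p))

    Max⇒IsMax : ∀ (p : Coset I J) {x} → x ∈ elems p → Max I J x → IsMax p x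
    Max⇒IsMax p x∈p x-max = x∈p , λ y y∈p → elems-≤ᴮ p x∈p y∈p x-max ≤ᴮ-refl

    Min⇒IsMin : ∀ (p : Coset I J) {x} → x ∈ elems p → Min I J x → IsMin p x
    Min⇒IsMin p x∈p x-min = x∈p , λ y y∈p → ≤ᴮ-elems p x∈p y∈p x-min ≤ᴮ-refl

    -- An enumeration, possibly with repetitions, from which elements of extreme length are
    -- computed.
    coset-list : Coset I J → List Carrier
    coset-list (coset x) = cartesianProductWith (λ g h → g ∙ x ∙ h) (elements I) (elements J)

    ∈-coset-list : ∀ (p : Coset I J) {x} → x ∈ elems p → x ∈ₗ coset-list p
    ∈-coset-list p (g , h , g∈W , h∈W , x≈) = ∈-resp-≈ setoid (sym x≈)
      (∈-cartesianProductWith⁺ setoid setoid setoid (λ g≈ h≈ → ∙-cong (∙-congʳ g≈) h≈)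
        (Equivalence.to (complete I g) g∈W) (Equivalence.to (complete J h) h∈W))

    coset-list⊆elems : ∀ (p : Coset I J) → All (elems p) (coset-list p)
    coset-list⊆elems p = cartesianProductWith⁺ setoid setoid _ (elements I) (elements J) λ g∈ h∈ →
      _ , _ , Equivalence.from (complete I _) g∈ , Equivalence.from (complete J _) h∈ , refl

    ∃-max : ∀ (p : Coset I J) → ∃[ x ] x ∈ elems p × Max I J x
    -- The default value `r` is itself in the coset, so `argmax` cannot leave it.
    ∃-max p@(coset r) = x , x∈p , longest⇒Max p x∈p λ y∈p → All.lookupₛ setoid
        (λ y≈z → ≡.subst (_≤ ℓ x) (ℓ-cong y≈z)) (f[xs]≤f[argmax] {f = ℓ} r (coset-list p)) (∈-coset-list p y∈p)
      where
      x = argmax ℓ r (coset-list p)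
      x∈p : x ∈ elems p
      x∈p = argmax-all ℓ (coset-refl r) (coset-list⊆elems p)

    ∃-min : ∀ (p : Coset I J) → ∃[ x ] x ∈ elems p × (∀ {y} → y ∈ elems p → ℓ x ≤ ℓ y)
    ∃-min p@(coset r) = x , x∈p , λ y∈p → All.lookupₛ setoid
        (λ y≈z → ≡.subst (ℓ x ≤_) (ℓ-cong y≈z)) (f[argmin]≤f[xs] {f = ℓ} r (coset-list p)) (∈-coset-list p y∈p)
      where
      x = argmin ℓ r (coset-list p)
      x∈p : x ∈ elems p
      x∈p = argmin-all ℓ (coset-refl r) (coset-list⊆elems p)

  -- Longest elements

  longest∈W : ∀ I → longest I ∈ W[ I ]
  longest∈W I = argmax-all ℓ Parabolic-ε
    (All.tabulateₛ setoid (Equivalence.from (complete I _)))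

  ℓ≤ℓ-longest : ∀ I {x} → x ∈ W[ I ] → ℓ x ≤ ℓ (longest I)
  ℓ≤ℓ-longest I x∈W = All.lookupₛ setoid (λ y≈z → ≡.subst (_≤ ℓ (longest I)) (ℓ-cong y≈z))
    (f[xs]≤f[argmax] {f = ℓ} ε (elements I)) (Equivalence.to (complete I _) x∈W)

  longest-leftMax : ∀ I → LeftMax I (longest I)
  longest-leftMax I s∈I = ℓ≤ℓ-longest I (Parabolic-∙ (Parabolic-ι s∈I) (longest∈W I))

  longest-rightMax : ∀ I → RightMax I (longest I)
  longest-rightMax I s∈I = ℓ≤ℓ-longest I (Parabolic-∙ (longest∈W I) (Parabolic-ι s∈I))

  ≤ᴮ-longest : ∀ I {x} → x ∈ W[ I ] → x ≤ᴮ longest I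
  ≤ᴮ-longest I x∈W = elems-≤ᴮ {I} {I} (coset ε) (∈-coset-ε (longest∈W I)) (∈-coset-ε x∈W)
    (longest-leftMax I , longest-rightMax I) ≤ᴮ-refl
    where
    ∈-coset-ε : ∀ {x} → x ∈ W[ I ] → x ∈ elems {I} {I} (coset ε)
    ∈-coset-ε x∈W = _ , ε , x∈W , Parabolic-ε , sym (trans (identityʳ _) (identityʳ _))

  -- Equal subsets may carry different lists `elements`, so `longest` may select different
  -- representatives; both are Bruhat maxima of the same subgroup.
  longest-cong : ∀ I J → I ≐ᶠ J → longest I ≈ longest J
  longest-cong I J (I⊆J , J⊆I) = ≤ᴮ-antisym
    (≤ᴮ-longest J (Parabolic-resp I⊆J (longest∈W I)))
    (≤ᴮ-longest I (Parabolic-resp J⊆I (longest∈W J)))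

  -- The deletion property. A letter that raises the length is kept; otherwise exchange drops it
  -- together with one letter of the reduced tail, and since ℓ changes by at most one the result is
  -- reduced.
  reduced-sublist : ∀ u → ∃[ v ] v ⊆ u × ⟦ v ⟧ ≈ ⟦ u ⟧ × length v ≡ ℓ ⟦ u ⟧
  reduced-sublist []      = [] , [] , refl , ≡.sym ℓ-ε
  reduced-sublist (s ∷ u) with reduced-sublist u | ℓ (ι s ∙ ⟦ u ⟧) ℕ.≤? ℓ ⟦ u ⟧
  ... | v , v⊆u , v≈u , |v|≡ℓu | no  nle = s ∷ v , ≡.refl ∷ v⊆u , ∙-congˡ v≈u ,
    ≡.trans (≡.cong suc |v|≡ℓu) (ℕ.≤-antisym (ℕ.≰⇒> nle) (ℓ-ι∙ s _))
  ... | v , v⊆u , v≈u , |v|≡ℓu | yes le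
    with exchange v (ι-reflection s) (≡.subst₂ _≤_ (ℓ-cong (∙-congˡ (sym v≈u))) (ℓ-cong (sym v≈u)) le)
  ...   | i , eq = removeAt v i , s ∷ʳ ⊆-trans (removeAt-⊆ v i) v⊆u , eq′ , ℕ.≤-antisym
      (ℕ.s≤s⁻¹ (≡.subst (_≤ suc (ℓ (ι s ∙ ⟦ u ⟧))) (≡.trans (≡.sym |v|≡ℓu) (length-removeAt′ v i)) (ℓ≤ℓ-ι∙ s ⟦ u ⟧)))
      (ℓ-minimal _ (removeAt v i) eq′)
    where
    eq′ : ⟦ removeAt v i ⟧ ≈ ι s ∙ ⟦ u ⟧
    eq′ = trans eq (∙-congˡ v≈u)
    removeAt-⊆ : ∀ (w : List S) i → removeAt w i ⊆ w
    removeAt-⊆ (t ∷ w) zero    = t ∷ʳ ⊆-refl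
    removeAt-⊆ (t ∷ w) (suc i) = ≡.refl ∷ removeAt-⊆ w i

  ⊆-++⁻ : ∀ {w : List S} u {v} → w ⊆ u ++ v → ∃[ w₁ ] ∃[ w₂ ] w ≡ w₁ ++ w₂ × w₁ ⊆ u × w₂ ⊆ v
  ⊆-++⁻ []      w⊆v           = [] , _ , ≡.refl , [] , w⊆v
  ⊆-++⁻ (s ∷ u) (.s ∷ʳ w⊆uv)  with ⊆-++⁻ u w⊆uv
  ... | w₁ , w₂ , eq , w₁⊆u , w₂⊆v = w₁ , w₂ , eq , s ∷ʳ w₁⊆u , w₂⊆v
  ⊆-++⁻ (s ∷ u) (≡.refl ∷ w⊆uv) with ⊆-++⁻ u w⊆uv
  ... | w₁ , w₂ , eq , w₁⊆u , w₂⊆v = s ∷ w₁ , w₂ , ≡.cong (s ∷_) eq , ≡.refl ∷ w₁⊆u , w₂⊆v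

  ⊆∧length≥⇒≡ : ∀ {u v : List S} → u ⊆ v → length v ≤ length u → u ≡ v
  ⊆∧length≥⇒≡ u⊆v le = Pointwise-≡⇒≡ (Sublist.toPointwise (ℕ.≤-antisym (Sublist.length-mono-≤ u⊆v) le) u⊆v)

  -- A reduced subword of word x ++ u cannot omit a letter of word x, since its
  -- first part still represents an element of xW_I.
  ℓ-minimal-∙ : ∀ I {x y} → (∀ {z} → z ∈ W[ I ] → ℓ x ≤ ℓ (x ∙ z)) → y ∈ W[ I ] → ℓ x ℕ.+ ℓ y ≤ ℓ (x ∙ y)
  ℓ-minimal-∙ I {x} {y} x-min (u , u⊆I , u≈y) with reduced-sublist (word x ++ u)
  ... | w , w⊆ , w≈ , |w|≡ with ⊆-++⁻ (word x) w⊆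
  ...   | w₁ , w₂ , ≡.refl , w₁⊆ , w₂⊆ = ≡.subst (ℓ x ℕ.+ ℓ y ≤_)
      (≡.trans (≡.sym (length-++ w₁)) (≡.trans |w|≡ (ℓ-cong xu≈xy)))
      (ℕ.+-mono-≤ ℓx≤|w₁| (ℓ-minimal y w₂ w₂≈y))
    where
    xu≈xy : ⟦ word x ++ u ⟧ ≈ x ∙ y
    xu≈xy = trans (⟦⟧-++ (word x) u) (∙-cong (⟦word⟧ x) u≈y)
    w₁w₂≈xy : ⟦ w₁ ⟧ ∙ ⟦ w₂ ⟧ ≈ x ∙ y
    w₁w₂≈xy = trans (sym (⟦⟧-++ w₁ w₂)) (trans w≈ xu≈xy)
    w₁≈ : x ∙ (y ∙ ⟦ w₂ ⟧ ⁻¹) ≈ ⟦ w₁ ⟧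
    w₁≈ = begin
      x ∙ (y ∙ ⟦ w₂ ⟧ ⁻¹)            ≈⟨ assoc _ _ _ ⟨
      x ∙ y ∙ ⟦ w₂ ⟧ ⁻¹              ≈⟨ ∙-congʳ w₁w₂≈xy ⟨
      ⟦ w₁ ⟧ ∙ ⟦ w₂ ⟧ ∙ ⟦ w₂ ⟧ ⁻¹    ≈⟨ cancelʳ (inverseʳ _) _ ⟩
      ⟦ w₁ ⟧                         ∎
    ℓx≤|w₁| : ℓ x ≤ length w₁
    ℓx≤|w₁| = ℕ.≤-trans (x-min (Parabolic-∙ (u , u⊆I , u≈y) (Parabolic-⁻¹ (w₂ , All-resp-⊆ w₂⊆ u⊆I , refl))))
      (ℓ-minimal _ w₁ (sym w₁≈))
    w₁≡ : w₁ ≡ word x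
    w₁≡ = ⊆∧length≥⇒≡ w₁⊆ (ℕ.≤-trans (ℕ.≤-reflexive (length-word x)) ℓx≤|w₁|)
    w₂≈y : ⟦ w₂ ⟧ ≈ y
    w₂≈y = ∙-cancelˡ x _ _ (trans (∙-congʳ (trans (sym (⟦word⟧ x)) (reflexive (≡.cong ⟦_⟧ (≡.sym w₁≡))))) w₁w₂≈xy)

  -- Turns a one-sided coset xW_I into a double coset, so that the results on extremal elements
  -- apply to it.
  ∅ : FinitarySubset
  ∅ = record
    { subset   = λ _ → Lift a ⊥
    ; elements = ε ∷ []
    ; complete = λ w → mk⇔
        (λ { ([] , [] , ε≈w) → here (sym ε≈w) ; (_ ∷ _ , lift () ∷ _ , _) })
        (λ { (here w≈ε) → [] , [] , sym w≈ε })
    }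

  -- Take y shortest in xW_I, so that lengths add on yW_I. Then y w_I ≤ x by maximality of x, while
  -- x = yh with h in W_I is no longer than y w_I; hence the two agree.
  RightMax-factor : ∀ I {x} → RightMax I x → ∃[ y ] x ≈ y ∙ longest I × ℓ x ≡ ℓ y ℕ.+ ℓ (longest I)
  RightMax-factor I {x} x-max with ∃-min {∅} {I} (coset x)
  ... | y , y∈xW , y-min with coset-sym {∅} {I} y∈xW
  ...   | _ , h , ([] , [] , ε≈g) , h∈W , x≈gyh =
      y , sym (≤ᴮ∧ℓ≥⇒≈ yw≤x (ℕ.≤-trans ℓx≤ additive)) , ℕ.≤-antisym ℓx≤ (ℕ.≤-trans additive (≤ᴮ⇒ℓ≤ yw≤x))
    where
    yw≤x : y ∙ longest I ≤ᴮ x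
    yw≤x = elems-≤ᴮ {∅} {I} (coset x) (coset-refl {∅} {I} x) (elems-∙ʳ {∅} {I} (coset x) y∈xW (longest∈W I))
      ((λ { (lift ()) }) , x-max) ≤ᴮ-refl
    x≈yh : x ≈ y ∙ h
    x≈yh = trans x≈gyh (∙-congʳ (elimˡ (sym ε≈g) y))
    ℓx≤ : ℓ x ≤ ℓ y ℕ.+ ℓ (longest I)
    ℓx≤ = ℕ.≤-trans (ℕ.≤-reflexive (ℓ-cong x≈yh)) (ℕ.≤-trans (ℓ-∙ y h) (ℕ.+-monoʳ-≤ (ℓ y) (ℓ≤ℓ-longest I h∈W)))
    additive : ℓ y ℕ.+ ℓ (longest I) ≤ ℓ (y ∙ longest I)
    additive = ℓ-minimal-∙ I (λ z∈W → y-min (elems-∙ʳ {∅} {I} (coset x) y∈xW z∈W)) (longest∈W I)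

  -- The word chosen by `ℓ-attained` is not known to use only letters of I. A reduced subword of a
  -- word in I does, and x absorbs each of its letters.
  longest-* : ∀ I {x} → LeftMax I x → longest I * x ≈ x
  longest-* I {x} x-max with longest∈W I
  ... | u , u⊆I , u≈ with reduced-sublist u
  ...   | v , v⊆u , v≈u , |v|≡ = trans
      (*≈⋆ v x (ℕ.≤-reflexive (≡.trans |v|≡ (ℓ-cong (sym v≈u)))) (trans v≈u u≈))
      (⋆-fixed v (All-resp-⊆ v⊆u u⊆I))
    where
    ⋆-fixed : ∀ v → All (subset I) v → v ⋆ x ≈ x
    ⋆-fixed []      []          = refl
    ⋆-fixed (s ∷ v) (s∈I ∷ v⊆I) = trans (*ˢ-cong s (⋆-fixed v v⊆I)) (*ˢ-down s x (x-max s∈I))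

  ℓ-*-max : ∀ I {x y} → RightMax I x → LeftMax I y → ℓ (x * y) ℕ.+ ℓ (longest I) ≤ ℓ x ℕ.+ ℓ y
  ℓ-*-max I {x} {y} x-max y-max =
    let z , x≈zw , ℓx≡ = RightMax-factor I x-max
        x*y≈z*y : x * y ≈ z * y
        x*y≈z*y = begin
          x * y                    ≈⟨ *-congʳ y x≈zw ⟩
          (z ∙ longest I) * y      ≈⟨ *-congʳ y (*-additive z (longest I) (ℕ.≤-reflexive (≡.trans (≡.sym ℓx≡) (ℓ-cong x≈zw)))) ⟨
          z * longest I * y        ≈⟨ *-assoc z (longest I) y ⟩
          z * (longest I * y)      ≈⟨ *-congˡ z (longest-* I {y} y-max) ⟩
          z * y                    ∎
    in ℕ.≤-trans
      (ℕ.+-monoˡ-≤ (ℓ (longest I)) (ℕ.≤-trans (ℕ.≤-reflexive (ℓ-cong x*y≈z*y)) (ℓ-* z y)))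
      (ℕ.≤-reflexive (≡.trans (xy∙z≈xz∙y (ℓ z) (ℓ y) (ℓ (longest I))) (≡.cong (ℕ._+ ℓ y) (≡.sym ℓx≡))))

  -- w_K has every generator of I as a right descent, so it factors as y w_I with additive lengths,
  -- and y is the quotient.
  ℓ-longest-quotient : ∀ I K → (∀ {s} → s ∈ subset I → s ∈ subset K) →
                       ℓ (longest K ∙ longest I ⁻¹) ℕ.+ ℓ (longest I) ≡ ℓ (longest K)
  ℓ-longest-quotient I K I⊆K =
    let y , wK≈ywI , ℓwK≡ = RightMax-factor I {longest K} (λ s∈I → longest-rightMax K (I⊆K s∈I)) in
    ≡.trans (≡.cong (ℕ._+ ℓ (longest I)) (ℓ-cong (trans (∙-congʳ wK≈ywI) (cancelʳ (inverseʳ _) y)))) (≡.sym ℓwK≡)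

  -- Expressions

  starProduct-leftMax : ∀ {I J} (E : Expression I J) → LeftMax I (starProduct E)
  starProduct-leftMax {I} (stop _)     = longest-leftMax I
  starProduct-leftMax {I} (add _ E)    = *-leftMax {I} (starProduct E) (longest-leftMax I)
  starProduct-leftMax {I} (remove _ E) = *-leftMax {I} (starProduct E) (longest-leftMax I)

  starProduct-replaceStart : ∀ {I J K} (I≐J : I ≐ᶠ J) (E : Expression J K) →
                             starProduct (replaceStart {I} {J} I≐J E) ≈ starProduct E
  starProduct-replaceStart {I} {J} I≐J (stop _)     = longest-cong I J I≐J
  starProduct-replaceStart {I} {J} I≐J (add _ E)    = *-congʳ (starProduct E) (longest-cong I J I≐J)
  starProduct-replaceStart {I} {J} I≐J (remove _ E) = *-congʳ (starProduct E) (longest-cong I J I≐J)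

  -- The joint J occurs in both factors but once in the concatenation; the extra w_J is absorbed
  -- because the product of F is left maximal for J.
  starProduct-∘ : ∀ {I J K} (E : Expression I J) (F : Expression J K) →
                  starProduct (E ∘ᴱ F) ≈ starProduct E * starProduct F
  starProduct-∘ {I} {J} (stop I≐J) F = begin
    starProduct (replaceStart {I} {J} I≐J F)    ≈⟨ starProduct-replaceStart {I} {J} I≐J F ⟩
    starProduct F                       ≈⟨ longest-* J (starProduct-leftMax F) ⟨
    longest J * starProduct F           ≈⟨ *-congʳ (starProduct F) (longest-cong I J I≐J) ⟨
    longest I * starProduct F           ∎
  starProduct-∘ {I} (add _ E) F =
    trans (*-congˡ (longest I) (starProduct-∘ E F)) (sym (*-assoc (longest I) (starProduct E) (starProduct F)))
  starProduct-∘ {I} (remove _ E) F =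
    trans (*-congˡ (longest I) (starProduct-∘ E F)) (sym (*-assoc (longest I) (starProduct E) (starProduct F)))

  -- Factor lengths of expressions and their concatenations

  risingLength : ∀ {I J} → Expression I J → ℕ
  risingLength E = sum (map ℓ (risingFactors E))

  fallingLength : ∀ {I J} → FinitarySubset → Expression I J → ℕ
  fallingLength K E = sum (map ℓ (fallingFactors K E))

  ⋖⇒⊆ : ∀ {I J : FinitarySubset} → I ⋖ J → ∀ {s} → s ∈ subset I → s ∈ subset J
  ⋖⇒⊆ (_ , _ , _ , I∪s⊆J) s∈I = I∪s⊆J (inj₁ s∈I)

  -- The descent from K may be cut at I: a quotient of length ℓ w_K - ℓ w_I, then a fresh start from
  -- I. For a further removal to J, the formulas with peaks K and I share `risingLength E`, which is
  -- eliminated; additive form avoids truncated subtraction.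
  fallingLength-formula : ∀ {I J} K (E : Expression I J) → (∀ {s} → s ∈ subset I → s ∈ subset K) →
    fallingLength K E ℕ.+ ℓ (longest I) ≡ ℓ (longest K) ℕ.+ risingLength E
  fallingLength-formula {I} K (stop _) I⊆K = ≡.trans
    (≡.cong (ℕ._+ ℓ (longest I)) (ℕ.+-identityʳ (ℓ (longest K))))
    (≡.cong (ℓ (longest K) ℕ.+_) (≡.sym (ℕ.+-identityʳ (ℓ (longest I)))))
  fallingLength-formula {I} K (add _ E) I⊆K = ≡.trans
    (xy∙z≈xz∙y (ℓ (longest K ∙ longest I ⁻¹)) (risingLength E) (ℓ (longest I)))
    (≡.cong (ℕ._+ risingLength E) (ℓ-longest-quotient I K I⊆K))
  fallingLength-formula {I} K (remove {J = J} J⋖I E) I⊆K =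
    +-eliminate (fallingLength K E) (ℓ (longest J)) (ℓ (longest K)) (risingLength E) (fallingLength I E) (ℓ (longest I))
      (fallingLength-formula K E (λ s∈J → I⊆K (⋖⇒⊆ {J} {I} J⋖I s∈J)))
      (fallingLength-formula I E (⋖⇒⊆ {J} {I} J⋖I))

  risingLength-replaceStart : ∀ {I J K} (I≐J : I ≐ᶠ J) (E : Expression J K) →
                              risingLength (replaceStart {I} {J} I≐J E) ≡ risingLength E
  risingLength-replaceStart {I} {J} I≐J (stop _)  = ≡.cong (ℕ._+ 0) (ℓ-cong (longest-cong I J I≐J))
  risingLength-replaceStart {I} {J} I≐J (add _ E) = ≡.refl
  risingLength-replaceStart {I} {J} I≐J (remove {J = L} L⋖J E) = ℕ.+-cancelʳ-≡ (ℓ (longest L)) _ _ (≡.trans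
    (fallingLength-formula I E (λ s∈L → proj₂ I≐J (⋖⇒⊆ {L} {J} L⋖J s∈L))) (≡.trans
    (≡.cong (ℕ._+ risingLength E) (ℓ-cong (longest-cong I J I≐J)))
    (≡.sym (fallingLength-formula J E (⋖⇒⊆ {L} {J} L⋖J)))))

  -- The correction is ℓ w_J whether J becomes a peak, a valley or a point on a slope. At a valley
  -- it is the w_J⁻¹ of the new quotient; elsewhere it removes a surplus w_J from one of the two
  -- parts.
  risingLength-∘ : ∀ {I J K} (E : Expression I J) (F : Expression J K) →
                   risingLength (E ∘ᴱ F) ℕ.+ ℓ (longest J) ≡ risingLength E ℕ.+ risingLength F
  risingLength-∘ {I} {J} (stop I≐J) F = ≡.trans (ℕ.+-comm _ (ℓ (longest J))) (≡.cong₂ ℕ._+_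
    (≡.trans (ℓ-cong (sym (longest-cong I J I≐J))) (≡.sym (ℕ.+-identityʳ _)))
    (risingLength-replaceStart {I} {J} I≐J F))
  risingLength-∘ (add _ E) F = risingLength-∘ E F
  risingLength-∘ {I} {J} (remove {J = L} L⋖I E) F = ℕ.+-cancelʳ-≡ (ℓ (longest L)) _ _ (≡.trans
    (xy∙z≈xz∙y (fallingLength I (E ∘ᴱ F)) (ℓ (longest J)) (ℓ (longest L))) (≡.trans
    (≡.cong (ℕ._+ ℓ (longest J)) (fallingLength-formula I (E ∘ᴱ F) L⊆I)) (≡.trans
    (ℕ.+-assoc (ℓ (longest I)) _ _) (≡.trans
    (≡.cong (ℓ (longest I) ℕ.+_) (risingLength-∘ E F)) (≡.trans
    (≡.sym (ℕ.+-assoc (ℓ (longest I)) _ _)) (≡.trans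
    (≡.cong (ℕ._+ risingLength F) (≡.sym (fallingLength-formula I E L⊆I)))
    (xy∙z≈xz∙y (fallingLength I E) (ℓ (longest L)) (risingLength F))))))))
    where
    L⊆I : ∀ {s} → s ∈ subset L → s ∈ subset I
    L⊆I = ⋖⇒⊆ {L} {I} L⋖I

  -- Strict monotonicity of the product of cosets

  module _ {I J K L : FinitarySubset} where

    *-strictMono : (p : Coset K I) (q q′ : Coset I J) (r : Coset J L) (u : Coset K L) → q′ <ᶜ q →
      ∀ {x y z t} → IsMax p x → IsMax q y → IsMax r z → IsMax u t → t ≈ x * y * z →
      ℓ t ℕ.+ ℓ (longest J) ℕ.+ ℓ (longest I) ≡ ℓ x ℕ.+ ℓ y ℕ.+ ℓ z →
      ∃[ pq′ ] ∃[ pq′r ] (IsProduct p q′ pq′ × IsProduct pq′ r pq′r × pq′r <ᶜ u)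
    *-strictMono p q q′ r u ((m′ , m , m′-min , m-min , m′≤m) , q′≉q) {x} {y} {z} {t}
      x-IsMax y-IsMax z-IsMax t-IsMax t≈xyz ℓt =
      pq′ , pq′r ,
      (x , y′ , x-IsMax , Max⇒IsMax q′ y′∈q′ y′-max , xy′-IsMax) ,
      (x * y′ , z , xy′-IsMax , z-IsMax , n-IsMax) ,
      (k′ , k , k′-IsMin , k-IsMin , k′≤k) , pq′r≉u
      where
      y′ : Carrier
      y′ = proj₁ (∃-max q′)
      y′∈q′ : y′ ∈ elems q′
      y′∈q′ = proj₁ (proj₂ (∃-max q′))
      y′-max : Max I J y′
      y′-max = proj₂ (proj₂ (∃-max q′))

      n : Carrier
      n = x * y′ * z

      pq′ : Coset K J
      pq′ = coset (x * y′)
      pq′r : Coset K L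
      pq′r = coset n

      x-max : Max K I x
      x-max = IsMax⇒Max p x-IsMax
      y-max : Max I J y
      y-max = IsMax⇒Max q y-IsMax
      z-max : Max J L z
      z-max = IsMax⇒Max r z-IsMax
      xy′-max : Max K J (x * y′)
      xy′-max = *-leftMax {K} y′ (proj₁ x-max) , *-rightMax {J} x (proj₂ y′-max)
      xy′-IsMax : IsMax pq′ (x * y′)
      xy′-IsMax = Max⇒IsMax pq′ (coset-refl {K} {J} (x * y′)) xy′-max
      n∈pq′r : n ∈ elems pq′r
      n∈pq′r = coset-refl {K} {L} n
      n-IsMax : IsMax pq′r n
      n-IsMax = Max⇒IsMax pq′r n∈pq′r (*-leftMax {K} z (proj₁ xy′-max) , *-rightMax {L} (x * y′) (proj₂ z-max))

      y′≤y : y′ ≤ᴮ y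
      -- The minimum m′ of q′ satisfies m′ ≤ m ≤ y; maximality of y then brings all of q′, in
      -- particular y′, below y.
      y′≤y = elems-≤ᴮ q′ (proj₁ m′-min) y′∈q′ y-max (≤ᴮ-trans m′≤m (proj₂ m-min y (proj₁ y-IsMax)))

      n≤t : n ≤ᴮ t
      n≤t = ≤ᴮ-resp refl (sym t≈xyz) (*-monoˡ z (*-monoʳ x y′≤y))

      k′ : Carrier
      k′ = proj₁ (∃-min pq′r)
      k′∈pq′r : k′ ∈ elems pq′r
      k′∈pq′r = proj₁ (proj₂ (∃-min pq′r))
      k′-min : Min K L k′
      k′-min = shortest⇒Min pq′r k′∈pq′r (proj₂ (proj₂ (∃-min pq′r)))
      k′-IsMin : IsMin pq′r k′
      k′-IsMin = Min⇒IsMin pq′r k′∈pq′r k′-min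
      k : Carrier
      k = proj₁ (∃-min u)
      k∈u : k ∈ elems u
      k∈u = proj₁ (proj₂ (∃-min u))
      k-IsMin : IsMin u k
      k-IsMin = Min⇒IsMin u k∈u (shortest⇒Min u k∈u (proj₂ (proj₂ (∃-min u))))
      k′≤k : k′ ≤ᴮ k
      -- Dually, k′ ≤ n ≤ t with t in u, and minimality of k′ puts it below every element of u.
      k′≤k = ≤ᴮ-elems u (proj₁ t-IsMax) k∈u k′-min (≤ᴮ-trans (proj₂ k′-IsMin n n∈pq′r) n≤t)

      ℓy′<ℓy : ℓ y′ < ℓ y
      -- Without a drop in length y′ and y would be equal, and the cosets q′ and q would meet and
      -- hence coincide.
      ℓy′<ℓy = ℕ.≰⇒> λ ℓy≤ℓy′ → q′≉q (common⇒≈ᶜ q′ q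
        (elems-resp q′ (≤ᴮ∧ℓ≥⇒≈ y′≤y ℓy≤ℓy′) y′∈q′) (proj₁ y-IsMax))

      ℓn≤ : ℓ n ℕ.+ ℓ (longest J) ℕ.+ ℓ (longest I) ≤ ℓ x ℕ.+ ℓ y′ ℕ.+ ℓ z
      ℓn≤ = +-chain-≤ (ℓ n) (ℓ (longest I)) (ℓ (longest J)) (ℓ x) (ℓ y′) (ℓ z) (ℓ (x * y′))
        (ℓ-*-max J {x * y′} {z} (proj₂ xy′-max) (proj₁ z-max))
        (ℓ-*-max I {x} {y′} (proj₂ x-max) (proj₁ y′-max))

      ℓn<ℓt : ℓ n < ℓ t
      ℓn<ℓt = ℕ.+-cancelʳ-< (ℓ (longest J)) (ℓ n) (ℓ t) (ℕ.+-cancelʳ-< (ℓ (longest I)) _ _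
        (ℕ.≤-<-trans ℓn≤ (ℕ.<-≤-trans (ℕ.+-monoˡ-< (ℓ z) (ℕ.+-monoʳ-< (ℓ x) ℓy′<ℓy)) (ℕ.≤-reflexive (≡.sym ℓt)))))

      pq′r≉u : ¬ (pq′r ≈ᶜ u)
      pq′r≉u (_ , u⊆pq′r) =
        contradiction (≤ᴮ⇒ℓ≤ (proj₂ n-IsMax t (u⊆pq′r (proj₁ t-IsMax)))) (ℕ.<⇒≱ ℓn<ℓt)

  starProduct-triple : ∀ {I J K L} (P : Expression K I) (Q : Expression I J) (R : Expression J L) →
    starProduct (P ∘ᴱ (Q ∘ᴱ R)) ≈ starProduct P * starProduct Q * starProduct R
  starProduct-triple P Q R = begin
    starProduct (P ∘ᴱ (Q ∘ᴱ R))                          ≈⟨ starProduct-∘ P (Q ∘ᴱ R) ⟩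
    starProduct P * starProduct (Q ∘ᴱ R)                 ≈⟨ *-congˡ (starProduct P) (starProduct-∘ Q R) ⟩
    starProduct P * (starProduct Q * starProduct R)      ≈⟨ *-assoc (starProduct P) (starProduct Q) (starProduct R) ⟨
    starProduct P * starProduct Q * starProduct R        ∎

  ℓ-starProduct-triple : ∀ {I J K L} (P : Expression K I) (Q : Expression I J) (R : Expression J L) →
    Reduced P → Reduced Q → Reduced R → Reduced (P ∘ᴱ (Q ∘ᴱ R)) →
    ℓ (starProduct (P ∘ᴱ (Q ∘ᴱ R))) ℕ.+ ℓ (longest J) ℕ.+ ℓ (longest I) ≡
    ℓ (starProduct P) ℕ.+ ℓ (starProduct Q) ℕ.+ ℓ (starProduct R)
  ℓ-starProduct-triple {I} {J} P Q R (_ , ℓP) (_ , ℓQ) (_ , ℓR) (_ , ℓPQR) = ≡.trans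
    (≡.cong (λ k → k ℕ.+ ℓ (longest J) ℕ.+ ℓ (longest I)) ℓPQR) (≡.trans
    (+-chain-≡ (risingLength (P ∘ᴱ (Q ∘ᴱ R))) (ℓ (longest I)) (ℓ (longest J))
      (risingLength P) (risingLength Q) (risingLength R) (risingLength (Q ∘ᴱ R))
      (risingLength-∘ P (Q ∘ᴱ R)) (risingLength-∘ Q R))
    (≡.cong₂ ℕ._+_ (≡.cong₂ ℕ._+_ (≡.sym ℓP) (≡.sym ℓQ)) (≡.sym ℓR)))

theorem2p20 : ∀ {c e a} (C : CoxeterSystem c e a) → let open Coxeter C in
    (I J K L : FinitarySubset) (q q′ : Coset I J) → q′ <ᶜ q →
    (p : Coset K I) (r : Coset J L) (pqr : Coset K L) →
    ReducedComposition p q r pqr →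
    ∃[ pq′ ] ∃[ pq′r ] (IsProduct p q′ pq′ × IsProduct pq′ r pq′r × pq′r <ᶜ pqr)
theorem2p20 C I J K L q q′ q′<q p r pqr
  (P , Q , R , (P-max , P-red) , (Q-max , Q-red) , (R-max , R-red) , (T-max , T-red)) =
  *-strictMono C p q q′ r pqr q′<q P-max Q-max R-max T-max
    (starProduct-triple C P Q R) (ℓ-starProduct-triple C P Q R P-red Q-red R-red T-red)
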